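{- Let $m \geq 1$ be an integer and let $q \in (m,m+1)$ be a Pisot number which is not an algebraic unit. Then every Galois conjugate $q'$ of $q$ satisfies $|q'| \geq \frac{2}{m+1} \geq c_m$.
   Context: A Pisot number is a real algebraic integer $q>1$ all of whose other Galois conjugates have absolute value strictly less than $1$. Define $c_1 = \frac{\sqrt{5}-1}{2}$; define $c_2$ to be the absolute value of the root of minimal modulus of $x^4-3x^3+x^2-2x-1$; and for $m \geq 3$ define $c_m = \frac{m+1-\sqrt{m^2+2m-3}}{2}$. -}

module Defs where

open import Level using (0ℓ)
open import Algebra.Bundles using (CommutativeRing)
open import Data.Integer.Base using (ℤ; +_; -[1+_])
open import Data.Nat.Base as ℕ using (ℕ; suc)
open import Data.Product.Base using (∃; ∃₂; _×_; _,_; proj₁)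
open import Data.Rational.Base as ℚ using (ℚ; ↥_; ↧ₙ_)
open import Data.Sum.Base using (_⊎_; inj₁; inj₂)
open import Data.Vec.Base using (Vec; []; _∷_; map)
open import Relation.Binary.Core using (Rel)
open import Relation.Binary.Definitions using (tri<; tri≈; tri>)
open import Relation.Binary.Structures using (IsStrictTotalOrder)
import Relation.Binary.Construct.StrictToNonStrict as ToNonStrict
open import Relation.Nullary.Negation.Core using (¬_)
open import Relation.Unary using (Pred; Satisfiable)

-- The real numbers are axiomatised, up to isomorphism, as a Dedekind-complete
-- ordered field.  The order is trichotomous, as in classical analysis.

record CompleteOrderedField : Set₁ where
  infix  8 _⁻¹
  infix  4 _<_
  field
    commutativeRing : CommutativeRing 0ℓ 0ℓ
  open CommutativeRing commutativeRing public
  field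
    _⁻¹                : Carrier → Carrier
    -- The value of 0# ⁻¹ is left unspecified.
    *-inverseʳ         : ∀ x → ¬ (x ≈ 0#) → x * x ⁻¹ ≈ 1#
    _<_                : Rel Carrier 0ℓ
    isStrictTotalOrder : IsStrictTotalOrder _≈_ _<_
    0<1                : 0# < 1#
    +-monoʳ-<          : ∀ x {y z} → y < z → x + y < x + z
    *-pos              : ∀ {x y} → 0# < x → 0# < y → 0# < x * y

  open ToNonStrict _≈_ _<_ public using (_≤_)

  UpperBound : Pred Carrier 0ℓ → Pred Carrier 0ℓ
  UpperBound S b = ∀ {x} → S x → x ≤ b

  LeastUpperBound : Pred Carrier 0ℓ → Pred Carrier 0ℓ
  LeastUpperBound S s = UpperBound S s × (∀ {b} → UpperBound S b → s ≤ b)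

  field
    supremum : ∀ S → Satisfiable S → Satisfiable (UpperBound S) →
               Satisfiable (LeastUpperBound S)

module Pisot (R : CompleteOrderedField) where
  open CompleteOrderedField R public hiding (_-_)
  open import Algebra.Definitions.RawMonoid +-rawMonoid
    using () renaming (_×_ to _·_)
  open import Algebra.Properties.Ring ring
    using (-‿distribˡ-*; -‿distribʳ-*; -‿involutive)
  open import Relation.Binary.Reasoning.Setoid setoid
  private
    module < = IsStrictTotalOrder isStrictTotalOrder

  ℝ : Set
  ℝ = Carrier

  infixl 6 _-_
  _-_ : ℝ → ℝ → ℝ
  x - y = x + - y

  fromℕ : ℕ → ℝ
  fromℕ n = n · 1#

  fromℤ : ℤ → ℝ
  fromℤ (+ n)    = fromℕ n
  fromℤ -[1+ n ] = - fromℕ (suc n)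

  fromℚ : ℚ → ℝ
  fromℚ p = fromℤ (↥ p) * fromℕ (↧ₙ p) ⁻¹

  private
    ≤-respʳ : ∀ {x y z} → y ≈ z → x ≤ y → x ≤ z
    ≤-respʳ y≈z (inj₁ x<y) = inj₁ (<.<-respʳ-≈ y≈z x<y)
    ≤-respʳ y≈z (inj₂ x≈y) = inj₂ (trans x≈y y≈z)

    ≤-trans : ∀ {x y z} → x ≤ y → y ≤ z → x ≤ z
    ≤-trans = ToNonStrict.trans _≈_ _<_ isEquivalence <.<-resp-≈ <.trans

    +-monoʳ-≤ : ∀ x {y z} → y ≤ z → x + y ≤ x + z
    +-monoʳ-≤ x (inj₁ y<z) = inj₁ (+-monoʳ-< x y<z)
    +-monoʳ-≤ x (inj₂ y≈z) = inj₂ (+-congˡ y≈z)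

    x≤1+x : ∀ x → x ≤ 1# + x
    x≤1+x x = ≤-respʳ (+-comm x 1#)
      (inj₁ (<.<-respˡ-≈ (+-identityʳ x) (+-monoʳ-< x 0<1)))

    0≤x*x : ∀ x → 0# ≤ x * x
    0≤x*x x with <.compare 0# x
    ... | tri< 0<x _ _ = inj₁ (*-pos 0<x 0<x)
    ... | tri≈ _ 0≈x _ = inj₂ (trans (sym (zeroˡ x)) (*-congʳ 0≈x))
    ... | tri> _ _ x<0 = ≤-respʳ eq (inj₁ (*-pos 0<-x 0<-x))
      where
      0<-x : 0# < - x
      0<-x = <.<-respˡ-≈ (-‿inverseˡ x)
               (<.<-respʳ-≈ (+-identityʳ (- x)) (+-monoʳ-< (- x) x<0))
      eq : - x * - x ≈ x * x
      eq = begin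
        - x * - x     ≈⟨ -‿distribˡ-* x (- x) ⟨
        - (x * - x)   ≈⟨ -‿cong (sym (-‿distribʳ-* x x)) ⟩
        - - (x * x)   ≈⟨ -‿involutive (x * x) ⟩
        x * x         ∎

    1≤1+x*x : ∀ x → 1# ≤ 1# + x * x
    1≤1+x*x x = ≤-trans (inj₂ (sym (+-identityʳ 1#))) (+-monoʳ-≤ 1# (0≤x*x x))

    x≤1+x*x : ∀ x → x ≤ 1# + x * x
    x≤1+x*x x with <.compare x 1#
    ... | tri< x<1 _ _ = ≤-trans (inj₁ x<1) (1≤1+x*x x)
    ... | tri≈ _ x≈1 _ = ≤-trans (inj₂ x≈1) (1≤1+x*x x)
    ... | tri> _ _ 1<x = ≤-trans x≤x*x (x≤1+x*x′)
      where
      0<x-1 : 0# < - 1# + x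
      0<x-1 = <.<-respˡ-≈ (-‿inverseˡ 1#) (+-monoʳ-< (- 1#) 1<x)
      eq : x + (- 1# + x) * x ≈ x * x
      eq = begin
        x + (- 1# + x) * x      ≈⟨ +-congʳ (*-identityˡ x) ⟨
        1# * x + (- 1# + x) * x ≈⟨ distribʳ x 1# (- 1# + x) ⟨
        (1# + (- 1# + x)) * x   ≈⟨ *-congʳ (+-assoc 1# (- 1#) x) ⟨
        (1# + - 1# + x) * x     ≈⟨ *-congʳ (+-congʳ (-‿inverseʳ 1#)) ⟩
        (0# + x) * x            ≈⟨ *-congʳ (+-identityˡ x) ⟩
        x * x                   ∎
      x≤x*x : x ≤ x * x
      x≤x*x = ≤-respʳ eq (≤-trans (inj₂ (sym (+-identityʳ x)))
                (+-monoʳ-≤ x (inj₁ (*-pos 0<x-1 (<.trans 0<1 1<x)))))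
      x≤1+x*x′ : x * x ≤ 1# + x * x
      x≤1+x*x′ = x≤1+x (x * x)

  SqrtSet : ℝ → Pred ℝ 0ℓ
  SqrtSet x y = (y * y ≤ x) ⊎ (y ≈ 0#)

  sqrtSet-bounded : ∀ x → Satisfiable (UpperBound (SqrtSet x))
  sqrtSet-bounded x with <.compare 0# x
  ... | tri> _ _ x<0 = 1# , λ
    { {y} (inj₁ yy≤x) → ≤-trans (x≤1+x*x y) (≤-trans (+-monoʳ-≤ 1# yy≤x)
                          (≤-respʳ (+-identityʳ 1#) (+-monoʳ-≤ 1# (inj₁ x<0))))
    ; (inj₂ y≈0)      → ≤-trans (inj₂ y≈0) (inj₁ 0<1) }
  ... | tri≈ _ 0≈x _ = 1# + x , λ
    { {y} (inj₁ yy≤x) → ≤-trans (x≤1+x*x y) (+-monoʳ-≤ 1# yy≤x)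
    ; (inj₂ y≈0)      → ≤-trans (inj₂ (trans y≈0 0≈x)) (x≤1+x x) }
  ... | tri< 0<x _ _ = 1# + x , λ
    { {y} (inj₁ yy≤x) → ≤-trans (x≤1+x*x y) (+-monoʳ-≤ 1# yy≤x)
    ; (inj₂ y≈0)      → ≤-trans (inj₂ y≈0) (≤-trans (inj₁ 0<x) (x≤1+x x)) }

  -- The supremum of { y ∣ y² ≤ x } ∪ { 0 }.  For 0 ≤ x the point 0 is already
  -- in the first set; for x < 0 it gives the conventional value √ x = 0.
  infix 8 √_
  √_ : ℝ → ℝ
  √ x = proj₁ (supremum (SqrtSet x) (0# , inj₂ refl) (sqrtSet-bounded x))

  record ℂ : Set where
    constructor _+i_
    field
      re im : ℝ
  open ℂ public

  infix  4 _≈ᶜ_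
  infixl 6 _+ᶜ_
  infixl 7 _*ᶜ_

  _≈ᶜ_ : Rel ℂ 0ℓ
  z ≈ᶜ w = re z ≈ re w × im z ≈ im w

  ofReal : ℝ → ℂ
  ofReal x = x +i 0#

  0ᶜ 1ᶜ : ℂ
  0ᶜ = ofReal 0#
  1ᶜ = ofReal 1#

  _+ᶜ_ _*ᶜ_ : ℂ → ℂ → ℂ
  z +ᶜ w = (re z + re w) +i (im z + im w)
  z *ᶜ w = (re z * re w - im z * im w) +i (re z * im w + im z * re w)

  ∣_∣ : ℂ → ℝ
  ∣ z ∣ = √ (re z * re z + im z * im z)

  -- The vector a₀ ∷ … ∷ aₙ₋₁ ∷ [] stands for the monic polynomial
  -- a₀ + a₁X + … + aₙ₋₁Xⁿ⁻¹ + Xⁿ; the leading coefficient 1 is implicit.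
  MonicPoly : Set → ℕ → Set
  MonicPoly = Vec

  eval : ∀ {n} → MonicPoly ℚ n → ℂ → ℂ
  eval []       z = 1ᶜ
  eval (a ∷ as) z = ofReal (fromℚ a) +ᶜ z *ᶜ eval as z

  Root : ∀ {n} → MonicPoly ℚ n → ℂ → Set
  Root p z = eval p z ≈ᶜ 0ᶜ

  fromℤ[X] : ∀ {n} → MonicPoly ℤ n → MonicPoly ℚ n
  fromℤ[X] = map (λ a → a ℚ./ 1)

  AlgebraicInteger : ℂ → Set
  AlgebraicInteger z = ∃₂ λ n (p : MonicPoly ℤ n) → Root (fromℤ[X] p) z

  AlgebraicUnit : ℂ → Set
  AlgebraicUnit z =
    AlgebraicInteger z × ∃ λ w → AlgebraicInteger w × z *ᶜ w ≈ᶜ 1ᶜ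

  IsMinimalPolynomial : ∀ {n} → MonicPoly ℚ n → ℂ → Set
  IsMinimalPolynomial {n} p z =
    Root p z × (∀ {k} → k ℕ.< n → (r : MonicPoly ℚ k) → ¬ Root r z)

  -- z itself counts among its conjugates.
  GaloisConjugate : ℂ → ℂ → Set
  GaloisConjugate z z′ =
    ∃₂ λ n (p : MonicPoly ℚ n) → IsMinimalPolynomial p z × Root p z′

  record IsPisot (q : ℝ) : Set where
    field
      algebraicInteger : AlgebraicInteger (ofReal q)
      1<q              : 1# < q
      conjugates<1     : ∀ z → GaloisConjugate (ofReal q) z →
                         ¬ (z ≈ᶜ ofReal q) → ∣ z ∣ < 1#

  -- X⁴ - 3X³ + X² - 2X - 1
  quartic : MonicPoly ℚ 4
  quartic = fromℤ[X] (-[1+ 0 ] ∷ -[1+ 1 ] ∷ + 1 ∷ -[1+ 2 ] ∷ [])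

  -- IsC m c says that c is the number cₘ.
  data IsC : ℕ → ℝ → Set where
    c₁ : ∀ {c} → c ≈ (√ fromℕ 5 - 1#) * fromℕ 2 ⁻¹ → IsC 1 c
    c₂ : ∀ {c} (z : ℂ) → Root quartic z →
         (∀ w → Root quartic w → ∣ z ∣ ≤ ∣ w ∣) →
         c ≈ ∣ z ∣ → IsC 2 c
    c₃₊ : ∀ {m c} → 3 ℕ.≤ m →
          c ≈ (fromℕ m + 1# - √ (fromℕ m * fromℕ m + fromℕ 2 * fromℕ m - fromℕ 3))
                * fromℕ 2 ⁻¹ →
          IsC m c

-- Let a₀ be the constant coefficient of the minimal polynomial P of q.  By
-- Gauss's lemma P has integer coefficients, and since q is neither 0 nor a
-- unit, ∣a₀∣ ≥ 2: if a₀ = ±1, the reversed polynomial makes 1/q integral.  As q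
-- is a simple root, P = (X - q)(X - q′)S for every conjugate q′ ≠ q, where all
-- roots of S lie in the unit disc, so that ∣S(0)∣ ≤ 1 and 2 ≤ ∣P(0)∣ ≤ q∣q′∣.
-- The bound on S(0) uses the fundamental theorem of algebra, which follows by
-- minimising the modulus of a polynomial.  The conclusion is an order relation,
-- hence ¬¬-stable, so existence statements are only needed up to ¬¬.

module Submission where

open import Defs
open import Algebra.Bundles using (CommutativeRing; RawRing)
import Algebra.Properties.Group
open import Algebra.Solver.Ring.AlmostCommutativeRing
  using (fromCommutativeRing; _-Raw-AlmostCommutative⟶_)
import Algebra.Solver.Ring as RingSolver
open import Data.Empty using (⊥; ⊥-elim)
open import Data.Integer.Base as ℤ using (ℤ; +_; -[1+_])
open import Data.Integer.Divisibility.Signed as ℤ∣ using (divides) renaming (_∣_ to _∣ℤ_)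
import Data.Integer.Properties as ℤ
open import Data.List.Base using ([]; _∷_)
open import Data.List.Relation.Unary.All using (All; []; _∷_)
open import Data.Maybe.Base using (Maybe; just; nothing)
open import Data.Nat.Base as ℕ using (ℕ; zero; suc)
import Data.Nat.Divisibility as ℕ∣
open import Data.Nat.Induction using (<-rec)
open import Data.Nat.ListAction using (product)
open import Data.Nat.Primality using (Prime; euclidsLemma; prime⇒nonZero)
open import Data.Nat.Primality.Factorisation using (factorise; module PrimeFactorisation)
import Data.Nat.Properties as ℕ
open import Data.Product.Base using (∃; ∃₂; _×_; _,_; proj₁; proj₂)
open import Data.Rational.Base as ℚ using (ℚ; ↥_; ↧_; ↧ₙ_; toℚᵘ)
import Data.Rational.Properties as ℚ
import Data.Rational.Unnormalised.Base as ℚᵘ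
import Data.Rational.Unnormalised.Properties as ℚᵘ
open import Data.Sum.Base as Sum using (_⊎_; inj₁; inj₂; [_,_]′)
open import Data.Vec.Base using (Vec; []; _∷_; map)
open import Function.Base using (_∘_; case_of_)
open import Level using (0ℓ)
open import Relation.Binary.Definitions using (tri<; tri≈; tri>)
import Relation.Binary.Construct.StrictToNonStrict as ToNonStrict
open import Relation.Binary.PropositionalEquality as ≡ using (_≡_)
open import Relation.Binary.Structures using (IsStrictTotalOrder)
open import Relation.Nullary.Decidable.Core using (Dec; yes; no)
open import Relation.Nullary.Negation.Core using (¬_; contradiction)

-- The modulus is a supremum, so the estimates are made for its square `N`, where they become
-- polynomial identities with visibly nonnegative terms. The order is trichotomous but the logic is
-- constructive: real induction, with its conclusion under ¬¬, takes the place of compactness. In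
-- particular no point where |P| is minimal is ever produced. Without a root every value of |P|²
-- exceeds the infimum μ, and the local margins above μ merge into a uniform one, so μ would not be
-- the greatest lower bound.
--
-- Lowering |P| at a point that is not a root usually takes a k-th root of a complex number. Here
-- square roots suffice, because for odd k one of the directions 1, -1, i, -i already serves.
--
-- Simplicity of q matters because otherwise q, which lies outside the unit disc, could again be a
-- root of S. It holds because P′ has degree n - 1 and nonzero leading coefficient n, so P′(q) = 0
-- would be a linear relation among 1, q, ..., qⁿ⁻¹.

private module ℚ+ = Algebra.Properties.Group ℚ.+-0-group

-- Integers in a commutative ring, and a ring solver with integer coefficients

module IntegerCoefficients {c ℓ} (R : CommutativeRing c ℓ) where
  open CommutativeRing R
  open import Algebra.Properties.Ring ring
    using (-‿distribˡ-*; -‿distribʳ-*; -‿involutive; -0#≈0#; -‿+-comm)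
  open import Algebra.Properties.Semiring.Mult semiring
    using (×-homo-+; ×1-homo-*) renaming (_×_ to _·_)
  open import Algebra.Properties.Semiring.Mult.TCOptimised semiring
    using (×ᵤ≈×) renaming (_×_ to _·′_)
  open import Relation.Binary.Reasoning.Setoid setoid

  fromℕ : ℕ → Carrier
  fromℕ n = n · 1#

  fromℤ : ℤ → Carrier
  fromℤ (+ n)    = fromℕ n
  fromℤ -[1+ n ] = - fromℕ (suc n)

  fromℕ-+ : ∀ m n → fromℕ (m ℕ.+ n) ≈ fromℕ m + fromℕ n
  fromℕ-+ m n = ×-homo-+ 1# m n

  fromℕ-* : ∀ m n → fromℕ (m ℕ.* n) ≈ fromℕ m * fromℕ n
  fromℕ-* = ×1-homo-*

  fromℕ-1 : fromℕ 1 ≈ 1#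
  fromℕ-1 = +-identityʳ 1#

  fromℤ-neg : ∀ i → fromℤ (ℤ.- i) ≈ - fromℤ i
  fromℤ-neg (+ zero)  = sym -0#≈0#
  fromℤ-neg (+ suc n) = refl
  fromℤ-neg -[1+ n ]  = sym (-‿involutive _)

  private
    fromℤ-⊖ : ∀ m n → fromℤ (m ℤ.⊖ n) ≈ fromℕ m - fromℕ n
    fromℤ-⊖ m       zero    = sym (trans (+-congˡ -0#≈0#) (+-identityʳ _))
    fromℤ-⊖ zero    (suc n) = sym (+-identityˡ _)
    fromℤ-⊖ (suc m) (suc n) = begin
      fromℤ (suc m ℤ.⊖ suc n)              ≡⟨ ≡.cong fromℤ (ℤ.[1+m]⊖[1+n]≡m⊖n m n) ⟩
      fromℤ (m ℤ.⊖ n)                      ≈⟨ fromℤ-⊖ m n ⟩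
      fromℕ m - fromℕ n                    ≈⟨ +-congʳ (+-identityʳ _) ⟨
      fromℕ m + 0# - fromℕ n               ≈⟨ +-congʳ (+-congˡ (-‿inverseʳ 1#)) ⟨
      fromℕ m + (1# - 1#) - fromℕ n        ≈⟨ +-congʳ (+-assoc _ _ _) ⟨
      fromℕ m + 1# - 1# - fromℕ n          ≈⟨ +-assoc _ _ _ ⟩
      fromℕ m + 1# + (- 1# - fromℕ n)      ≈⟨ +-cong (+-comm _ _) (-‿+-comm _ _) ⟩
      fromℕ (suc m) - fromℕ (suc n)        ∎

  fromℤ-+ : ∀ i j → fromℤ (i ℤ.+ j) ≈ fromℤ i + fromℤ j
  fromℤ-+ (+ m)    (+ n)    = fromℕ-+ m n
  fromℤ-+ (+ m)    -[1+ n ] = fromℤ-⊖ m (suc n)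
  fromℤ-+ -[1+ m ] (+ n)    = trans (fromℤ-⊖ n (suc m)) (+-comm _ _)
  fromℤ-+ -[1+ m ] -[1+ n ] = begin
    - fromℕ (suc (suc (m ℕ.+ n)))      ≡⟨ ≡.cong (λ k → - fromℕ (suc k)) (ℕ.+-suc m n) ⟨
    - fromℕ (suc m ℕ.+ suc n)          ≈⟨ -‿cong (fromℕ-+ (suc m) (suc n)) ⟩
    - (fromℕ (suc m) + fromℕ (suc n))  ≈⟨ -‿+-comm _ _ ⟨
    - fromℕ (suc m) - fromℕ (suc n)    ∎

  private
    fromℤ-*₊ : ∀ m j → fromℤ (+ m ℤ.* j) ≈ fromℕ m * fromℤ j
    fromℤ-*₊ m (+ n) = trans (reflexive (≡.cong fromℤ (≡.sym (ℤ.pos-* m n)))) (fromℕ-* m n)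
    fromℤ-*₊ m -[1+ n ] = begin
      fromℤ (+ m ℤ.* ℤ.- (+ suc n))     ≡⟨ ≡.cong fromℤ (ℤ.neg-distribʳ-* (+ m) (+ suc n)) ⟨
      fromℤ (ℤ.- (+ m ℤ.* + suc n))     ≈⟨ fromℤ-neg (+ m ℤ.* + suc n) ⟩
      - fromℤ (+ m ℤ.* + suc n)         ≈⟨ -‿cong (fromℤ-*₊ m (+ suc n)) ⟩
      - (fromℕ m * fromℕ (suc n))       ≈⟨ -‿distribʳ-* _ _ ⟩
      fromℕ m * - fromℕ (suc n)         ∎

  fromℤ-* : ∀ i j → fromℤ (i ℤ.* j) ≈ fromℤ i * fromℤ j
  fromℤ-* (+ m)    j = fromℤ-*₊ m j
  fromℤ-* -[1+ m ] j = begin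
    fromℤ (ℤ.- (+ suc m) ℤ.* j)      ≡⟨ ≡.cong fromℤ (ℤ.neg-distribˡ-* (+ suc m) j) ⟨
    fromℤ (ℤ.- (+ suc m ℤ.* j))      ≈⟨ fromℤ-neg (+ suc m ℤ.* j) ⟩
    - fromℤ (+ suc m ℤ.* j)          ≈⟨ -‿cong (fromℤ-*₊ (suc m) j) ⟩
    - (fromℕ (suc m) * fromℤ j)      ≈⟨ -‿distribˡ-* _ _ ⟩
    - fromℕ (suc m) * fromℤ j        ∎

  private
    -- Agrees with fromℤ, but sends the numerals 1, 2, … of the solver to
    -- 1#, 1# + 1#, … on the nose.
    numeral : ℤ → Carrier
    numeral (+ n)    = n ·′ 1#
    numeral -[1+ n ] = - (suc n ·′ 1#)

    numeral≈fromℤ : ∀ i → numeral i ≈ fromℤ i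
    numeral≈fromℤ (+ n)    = sym (×ᵤ≈× n 1#)
    numeral≈fromℤ -[1+ n ] = -‿cong (sym (×ᵤ≈× (suc n) 1#))

    ℤ-rawRing : RawRing _ _
    ℤ-rawRing = record
      { _≈_ = _≡_ ; _+_ = ℤ._+_ ; _*_ = ℤ._*_ ; -_ = ℤ.-_ ; 0# = ℤ.0ℤ ; 1# = ℤ.1ℤ }

    numeral-homo : ℤ-rawRing -Raw-AlmostCommutative⟶ fromCommutativeRing R
    numeral-homo = record
      { ⟦_⟧    = numeral
      ; +-homo = λ i j → trans (numeral≈fromℤ (i ℤ.+ j)) (trans (fromℤ-+ i j)
                   (sym (+-cong (numeral≈fromℤ i) (numeral≈fromℤ j))))
      ; *-homo = λ i j → trans (numeral≈fromℤ (i ℤ.* j)) (trans (fromℤ-* i j)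
                   (sym (*-cong (numeral≈fromℤ i) (numeral≈fromℤ j))))
      ; -‿homo = λ i → trans (numeral≈fromℤ (ℤ.- i)) (trans (fromℤ-neg i)
                   (sym (-‿cong (numeral≈fromℤ i))))
      ; 0-homo = refl
      ; 1-homo = refl
      }

    numeral≟ : ∀ i j → Maybe (numeral i ≈ numeral j)
    numeral≟ i j with i ℤ.≟ j
    ... | yes ≡.refl = just refl
    ... | no _       = nothing

  open RingSolver ℤ-rawRing (fromCommutativeRing R) numeral-homo numeral≟ public
    using (solve; _:+_; _:*_; _:-_; :-_; _:=_; con)

-- Arithmetic of ordered fields

module OrderedField (R : CompleteOrderedField) where
  open Pisot R
  private module ℤ→ℝ = IntegerCoefficients commutativeRing
  open ℤ→ℝ public
    using (fromℕ-*; fromℕ-1; solve; _:+_; _:*_; _:-_; :-_; _:=_; con)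
  open import Relation.Binary.Reasoning.Setoid setoid

  open import Algebra.Properties.Ring ring public using (-‿involutive)

  private
    fromℤ≈ : ∀ i → fromℤ i ≈ ℤ→ℝ.fromℤ i
    fromℤ≈ (+ _)    = refl
    fromℤ≈ -[1+ _ ] = refl

  fromℤ-+ : ∀ i j → fromℤ (i ℤ.+ j) ≈ fromℤ i + fromℤ j
  fromℤ-+ i j = trans (fromℤ≈ (i ℤ.+ j)) (trans (ℤ→ℝ.fromℤ-+ i j)
    (sym (+-cong (fromℤ≈ i) (fromℤ≈ j))))

  fromℤ-* : ∀ i j → fromℤ (i ℤ.* j) ≈ fromℤ i * fromℤ j
  fromℤ-* i j = trans (fromℤ≈ (i ℤ.* j)) (trans (ℤ→ℝ.fromℤ-* i j)
    (sym (*-cong (fromℤ≈ i) (fromℤ≈ j))))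

  private module < = IsStrictTotalOrder isStrictTotalOrder
  open < public using (compare)
  module ≤ = ToNonStrict _≈_ _<_

  <-irrefl : ∀ {x} → ¬ (x < x)
  <-irrefl = <.irrefl refl

  <-trans : ∀ {x y z} → x < y → y < z → x < z
  <-trans = <.trans

  <-cong : ∀ {x y u v} → x ≈ u → y ≈ v → x < y → u < v
  <-cong p q = <.<-respˡ-≈ p ∘ <.<-respʳ-≈ q

  <⇒≤ : ∀ {x y} → x < y → x ≤ y
  <⇒≤ = inj₁

  ≤-reflexive : ∀ {x y} → x ≈ y → x ≤ y
  ≤-reflexive = inj₂

  ≤-refl : ∀ {x} → x ≤ x
  ≤-refl = inj₂ refl

  ≤-trans : ∀ {x y z} → x ≤ y → y ≤ z → x ≤ z
  ≤-trans = ≤.trans isEquivalence <.<-resp-≈ <.trans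

  <-≤-trans : ∀ {x y z} → x < y → y ≤ z → x < z
  <-≤-trans = ≤.<-≤-trans <.trans <.<-respʳ-≈

  ≤-<-trans : ∀ {x y z} → x ≤ y → y < z → x < z
  ≤-<-trans = ≤.≤-<-trans sym <.trans <.<-respˡ-≈

  ≤-cong : ∀ {x y u v} → x ≈ u → y ≈ v → x ≤ y → u ≤ v
  ≤-cong p q x≤y = ≤-trans (≤-reflexive (sym p)) (≤-trans x≤y (≤-reflexive q))

  ≤⇒≯ : ∀ {x y} → x ≤ y → ¬ (y < x)
  ≤⇒≯ x≤y y<x = <-irrefl (≤-<-trans x≤y y<x)

  ≤⊎> : ∀ x y → x ≤ y ⊎ y < x
  ≤⊎> x y with compare x y
  ... | tri< x<y _ _ = inj₁ (<⇒≤ x<y)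
  ... | tri≈ _ x≈y _ = inj₁ (≤-reflexive x≈y)
  ... | tri> _ _ y<x = inj₂ y<x

  ≮⇒≥ : ∀ {x y} → ¬ (x < y) → y ≤ x
  ≮⇒≥ {x} {y} x≮y = [ (λ y≤x → y≤x) , (λ x<y → contradiction x<y x≮y) ]′ (≤⊎> y x)

  ≰⇒> : ∀ {x y} → ¬ (x ≤ y) → y < x
  ≰⇒> {x} {y} x≰y = [ (λ x≤y → contradiction x≤y x≰y) , (λ y<x → y<x) ]′ (≤⊎> x y)

  ≤-antisym : ∀ {x y} → x ≤ y → y ≤ x → x ≈ y
  ≤-antisym {x} {y} x≤y y≤x with compare x y
  ... | tri< x<y _ _ = contradiction x<y (≤⇒≯ y≤x)
  ... | tri≈ _ x≈y _ = x≈y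
  ... | tri> _ _ y<x = contradiction y<x (≤⇒≯ x≤y)

  <⇒0<- : ∀ {x y} → x < y → 0# < y - x
  <⇒0<- {x} {y} x<y = <-cong (-‿inverseˡ x) (+-comm (- x) y) (+-monoʳ-< (- x) x<y)

  ≤⇒0≤- : ∀ {x y} → x ≤ y → 0# ≤ y - x
  ≤⇒0≤- (inj₁ x<y) = inj₁ (<⇒0<- x<y)
  ≤⇒0≤- {x} {y} (inj₂ x≈y) = inj₂ (sym (trans (+-congʳ (sym x≈y)) (-‿inverseʳ x)))

  -- The difference enters as a separate d with an equation, so that d can be a sum of visibly
  -- positive terms and the solver proves that it equals y - x. Most inequalities below are obtained
  -- in this way.
  0<⇒< : ∀ {x y d} → 0# < d → d ≈ y - x → x < y
  0<⇒< {x} {y} {d} 0<d d≈ = <-cong (+-identityʳ x)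
    (trans (+-congˡ d≈) (solve 2 (λ x y → x :+ (y :- x) := y) refl x y))
    (+-monoʳ-< x 0<d)

  0≤⇒≤ : ∀ {x y d} → 0# ≤ d → d ≈ y - x → x ≤ y
  0≤⇒≤ (inj₁ 0<d) d≈ = inj₁ (0<⇒< 0<d d≈)
  0≤⇒≤ {x} {y} {d} (inj₂ 0≈d) d≈ = inj₂ (begin
    x           ≈⟨ +-identityʳ x ⟨
    x + 0#      ≈⟨ +-congˡ (trans 0≈d d≈) ⟩
    x + (y - x) ≈⟨ solve 2 (λ x y → x :+ (y :- x) := y) refl x y ⟩
    y           ∎)

  +-monoˡ-< : ∀ x {y z} → y < z → y + x < z + x
  +-monoˡ-< x y<z = <-cong (+-comm _ _) (+-comm _ _) (+-monoʳ-< x y<z)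

  +-mono-< : ∀ {x y u v} → x < y → u < v → x + u < y + v
  +-mono-< {x} {y} {u} {v} x<y u<v = <-trans (+-monoʳ-< x u<v) (+-monoˡ-< v x<y)

  +-mono-≤ : ∀ {x y u v} → x ≤ y → u ≤ v → x + u ≤ y + v
  +-mono-≤ (inj₁ x<y) (inj₁ u<v) = inj₁ (+-mono-< x<y u<v)
  +-mono-≤ {y = y} (inj₁ x<y) (inj₂ u≈v) = inj₁ (<-cong refl (+-congˡ u≈v) (+-monoˡ-< _ x<y))
  +-mono-≤ (inj₂ x≈y) (inj₁ u<v) = inj₁ (<-cong (+-congʳ (sym x≈y)) refl (+-monoʳ-< _ u<v))
  +-mono-≤ (inj₂ x≈y) (inj₂ u≈v) = inj₂ (+-cong x≈y u≈v)

  +-mono-<-≤ : ∀ {x y u v} → x < y → u ≤ v → x + u < y + v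
  +-mono-<-≤ x<y (inj₁ u<v) = +-mono-< x<y u<v
  +-mono-<-≤ x<y (inj₂ u≈v) = <-cong refl (+-congˡ u≈v) (+-monoˡ-< _ x<y)

  0<+ : ∀ {x y} → 0# < x → 0# < y → 0# < x + y
  0<+ 0<x 0<y = <-cong (+-identityʳ 0#) refl (+-mono-< 0<x 0<y)

  0<+₁ : ∀ {x y} → 0# < x → 0# ≤ y → 0# < x + y
  0<+₁ 0<x 0≤y = <-cong (+-identityʳ 0#) refl (+-mono-<-≤ 0<x 0≤y)

  0≤+ : ∀ {x y} → 0# ≤ x → 0# ≤ y → 0# ≤ x + y
  0≤+ 0≤x 0≤y = ≤-cong (+-identityʳ 0#) refl (+-mono-≤ 0≤x 0≤y)

  0≤* : ∀ {x y} → 0# ≤ x → 0# ≤ y → 0# ≤ x * y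
  0≤* (inj₁ 0<x) (inj₁ 0<y) = inj₁ (*-pos 0<x 0<y)
  0≤* {x} {y} (inj₂ 0≈x) _ = inj₂ (trans (sym (zeroˡ y)) (*-congʳ 0≈x))
  0≤* {x} {y} (inj₁ _) (inj₂ 0≈y) = inj₂ (trans (sym (zeroʳ x)) (*-congˡ 0≈y))

  neg-pos : ∀ {x} → x < 0# → 0# < - x
  neg-pos {x} x<0 = <-cong refl (+-identityˡ (- x)) (<⇒0<- x<0)

  0≤² : ∀ x → 0# ≤ x * x
  0≤² x with compare 0# x
  ... | tri< 0<x _ _ = inj₁ (*-pos 0<x 0<x)
  ... | tri≈ _ 0≈x _ = 0≤* (inj₂ 0≈x) (inj₂ 0≈x)
  ... | tri> _ _ x<0 = ≤-cong refl (solve 1 (λ x → (:- x) :* (:- x) := x :* x) refl x)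
                         (inj₁ (*-pos (neg-pos x<0) (neg-pos x<0)))

  0<²  : ∀ {x} → ¬ (x ≈ 0#) → 0# < x * x
  0<² {x} x≉0 with compare 0# x
  ... | tri< 0<x _ _ = *-pos 0<x 0<x
  ... | tri≈ _ 0≈x _ = contradiction (sym 0≈x) x≉0
  ... | tri> _ _ x<0 = <-cong refl (solve 1 (λ x → (:- x) :* (:- x) := x :* x) refl x)
                         (*-pos (neg-pos x<0) (neg-pos x<0))

  >⇒≉ : ∀ {x y} → x < y → ¬ (y ≈ x)
  >⇒≉ x<y y≈x = <-irrefl (<-cong refl y≈x x<y)

  *-monoˡ-≤ : ∀ {x y z} → 0# ≤ z → x ≤ y → x * z ≤ y * z
  *-monoˡ-≤ {x} {y} {z} 0≤z x≤y = 0≤⇒≤ (0≤* (≤⇒0≤- x≤y) 0≤z)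
    (solve 3 (λ x y z → (y :- x) :* z := y :* z :- x :* z) refl x y z)

  *-monoˡ-< : ∀ {x y z} → 0# < z → x < y → x * z < y * z
  *-monoˡ-< {x} {y} {z} 0<z x<y = 0<⇒< (*-pos (<⇒0<- x<y) 0<z)
    (solve 3 (λ x y z → (y :- x) :* z := y :* z :- x :* z) refl x y z)

  *-mono-≤ : ∀ {x y u v} → 0# ≤ u → 0# ≤ y → x ≤ y → u ≤ v → x * u ≤ y * v
  *-mono-≤ {x} {y} {u} {v} 0≤u 0≤y x≤y u≤v = ≤-trans (*-monoˡ-≤ 0≤u x≤y)
    (≤-cong (*-comm _ _) (*-comm _ _) (*-monoˡ-≤ 0≤y u≤v))

  *-cancelˡ-≈0 : ∀ {x y} → ¬ (x ≈ 0#) → x * y ≈ 0# → y ≈ 0#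
  *-cancelˡ-≈0 {x} {y} x≉0 xy≈0 = begin
    y               ≈⟨ *-identityˡ y ⟨
    1# * y          ≈⟨ *-congʳ (*-inverseʳ x x≉0) ⟨
    x * x ⁻¹ * y    ≈⟨ solve 3 (λ x i y → x :* i :* y := x :* y :* i) refl x (x ⁻¹) y ⟩
    x * y * x ⁻¹    ≈⟨ *-congʳ xy≈0 ⟩
    0# * x ⁻¹       ≈⟨ zeroˡ _ ⟩
    0#              ∎

  ⁻¹-pos : ∀ {x} → 0# < x → 0# < x ⁻¹
  ⁻¹-pos {x} 0<x = ≰⇒> λ x⁻¹≤0 → <-irrefl (<-≤-trans 0<1 (0≤⇒≤
    (0≤* (<⇒≤ 0<x) (≤⇒0≤- x⁻¹≤0))
    (trans (solve 2 (λ x i → x :* (con (+ 0) :- i) := con (+ 0) :- x :* i) refl x (x ⁻¹))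
           (+-congˡ (-‿cong (*-inverseʳ x (>⇒≉ 0<x)))))))

  *-cancelʳ-≤ : ∀ {x y z} → 0# < z → x * z ≤ y * z → x ≤ y
  *-cancelʳ-≤ 0<z xz≤yz = ≮⇒≥ λ y<x → ≤⇒≯ xz≤yz (*-monoˡ-< 0<z y<x)

  -- If y < x, then x² - y² = (x - y)² + 2y (x - y) is positive. The sign of x is left free.
  ²-cancel-≤ : ∀ {x y} → 0# ≤ y → x * x ≤ y * y → x ≤ y
  ²-cancel-≤ {x} {y} 0≤y xx≤yy = ≮⇒≥ λ y<x → ≤⇒≯ xx≤yy
    (0<⇒< (0<+₁ (*-pos (<⇒0<- y<x) (<⇒0<- y<x))
                (0≤* (0≤+ 0≤y 0≤y) (≤⇒0≤- (<⇒≤ y<x))))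
      (solve 2 (λ x y → (x :- y) :* (x :- y) :+ (y :+ y) :* (x :- y)
                          := x :* x :- y :* y) refl x y))

  fromℕ-pos : ∀ n → 0# < fromℕ (suc n)
  fromℕ-pos zero    = <-cong refl (sym fromℕ-1) 0<1
  fromℕ-pos (suc n) = 0<+ 0<1 (fromℕ-pos n)

  fromℕ-nonneg : ∀ n → 0# ≤ fromℕ n
  fromℕ-nonneg zero    = ≤-refl
  fromℕ-nonneg (suc n) = <⇒≤ (fromℕ-pos n)

  fromℕ-mono : ∀ {m n} → m ℕ.≤ n → fromℕ m ≤ fromℕ n
  fromℕ-mono {n = n} ℕ.z≤n = fromℕ-nonneg n
  fromℕ-mono (ℕ.s≤s m≤n)   = +-mono-≤ ≤-refl (fromℕ-mono m≤n)

  -- The last component is what makes the minimum of two positive radii positive again.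
  min : ∀ x y → ∃ λ z → z ≤ x × z ≤ y × (∀ {w} → w < x → w < y → w < z)
  min x y with ≤⊎> x y
  ... | inj₁ x≤y = x , ≤-refl , x≤y , λ p _ → p
  ... | inj₂ y<x = y , <⇒≤ y<x , ≤-refl , λ _ p → p

  2# : ℝ
  2# = 1# + 1#

  0<2 : 0# < 2#
  0<2 = 0<+ 0<1 0<1

  half : ℝ → ℝ
  half x = x * 2# ⁻¹

  half+half : ∀ x → half x + half x ≈ x
  half+half x = begin
    x * 2# ⁻¹ + x * 2# ⁻¹ ≈⟨ solve 2 (λ x h → x :* h :+ x :* h := x :* ((con (+ 2)) :* h)) refl x (2# ⁻¹) ⟩
    x * (2# * 2# ⁻¹)      ≈⟨ *-congˡ (*-inverseʳ 2# (>⇒≉ 0<2)) ⟩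
    x * 1#                ≈⟨ *-identityʳ x ⟩
    x                     ∎

  half-pos : ∀ {x} → 0# < x → 0# < half x
  half-pos 0<x = *-pos 0<x (⁻¹-pos 0<2)

  half-nonneg : ∀ {x} → 0# ≤ x → 0# ≤ half x
  half-nonneg 0≤x = 0≤* 0≤x (<⇒≤ (⁻¹-pos 0<2))

  half< : ∀ {x} → 0# < x → half x < x
  half< {x} 0<x = <-cong (+-identityʳ _) (half+half x) (+-monoʳ-< (half x) (half-pos 0<x))

-- Real induction and the intermediate value theorem

module RealInduction (R : CompleteOrderedField) where
  open Pisot R
  open OrderedField R

  Near : ℝ → ℝ → ℝ → Set
  Near δ c t = c - δ < t × t < c + δ

  near-self : ∀ {δ c} → 0# < δ → Near δ c c
  near-self {δ} {c} 0<δ =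
      0<⇒< 0<δ (solve 2 (λ c d → d := c :- (c :- d)) refl c δ)
    , 0<⇒< 0<δ (solve 2 (λ c d → d := (c :+ d) :- c) refl c δ)

  near-weaken : ∀ {δ ε c t} → δ ≤ ε → Near δ c t → Near ε c t
  near-weaken {δ} {ε} {c} δ≤ε (l , u) =
      ≤-<-trans (0≤⇒≤ (≤⇒0≤- δ≤ε)
        (solve 3 (λ c d e → e :- d := (c :- d) :- (c :- e)) refl c δ ε)) l
    , <-≤-trans u (+-mono-≤ ≤-refl δ≤ε)

  -- A single point s at or just left of c transfers the property to every t of [A, B] near c, on
  -- either side. One condition thus covers both reaching the supremum and passing beyond it.
  Propagates : (ℝ → Set) → ℝ → ℝ → ℝ → Set
  Propagates S A B c = ∃ λ δ → 0# < δ × (∀ s t → A ≤ s → A ≤ t → t ≤ B →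
    Near δ c s → s ≤ c → Near δ c t → S s → S t)

  -- Let σ be the supremum of the points of [A, B] with S. Near σ no such point s can exist: it
  -- would propagate to B if σ is B, and to a point above σ otherwise. But then σ - δ is a smaller
  -- upper bound. The point s is only refuted, never found, hence the ¬¬.
  real-induction : (S : ℝ → Set) → ∀ {A B} → A ≤ B → S A →
    (∀ c → A ≤ c → c ≤ B → ¬ ¬ Propagates S A B c) → ¬ ¬ S B
  real-induction S {A} {B} A≤B SA step ¬SB =
    step σ A≤σ σ≤B λ { (δ , 0<δ , prop) →
      let σ-δ<σ = proj₁ (near-self {c = σ} 0<δ)
          σ<σ+δ = proj₂ (near-self {c = σ} 0<δ)
          no-s : ∀ {s} → T s → s ≤ σ - δ
          no-s {s} (A≤s , s≤B , Ss) = ≮⇒≥ λ σ-δ<s →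
            let s≤σ = ub (A≤s , s≤B , Ss)
                near-s = σ-δ<s , ≤-<-trans s≤σ σ<σ+δ
            in case ≤⊎> B σ of λ
              { (inj₁ B≤σ) → ¬SB (prop s B A≤s A≤B ≤-refl near-s s≤σ
                  (<-≤-trans σ-δ<σ σ≤B , ≤-<-trans B≤σ σ<σ+δ) Ss)
              ; (inj₂ σ<B) →
                  let σ+h<σ+δ = +-monoʳ-< σ (half< 0<δ)
                      -- Half of δ keeps u strictly inside the neighbourhood of σ while still beyond
                      -- σ.
                      (u , u≤B , u≤σ+h , u-max) = min B (σ + half δ)
                      σ<u = u-max σ<B (<-cong (+-identityʳ σ) refl (+-monoʳ-< σ (half-pos 0<δ)))
                      A≤u = ≤-trans A≤σ (<⇒≤ σ<u)
                      Su = prop s u A≤s A≤u u≤B near-s s≤σ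
                             (<-trans σ-δ<σ σ<u , ≤-<-trans u≤σ+h σ+h<σ+δ) Ss
                  in ≤⇒≯ (ub (A≤u , u≤B , Su)) σ<u }
      in ≤⇒≯ (least no-s) σ-δ<σ }
    where
    T : ℝ → Set
    T x = A ≤ x × x ≤ B × S x
    sup = supremum T (A , ≤-refl , A≤B , SA) (B , proj₁ ∘ proj₂)
    σ = proj₁ sup
    ub : UpperBound T σ
    ub = proj₁ (proj₂ sup)
    least : ∀ {b} → UpperBound T b → σ ≤ b
    least = proj₂ (proj₂ sup)
    A≤σ = ub (≤-refl , A≤B , SA)
    σ≤B = least (proj₁ ∘ proj₂)

  Continuous : (ℝ → ℝ) → Set
  Continuous f = ∀ c ε → 0# < ε → ∃ λ δ → 0# < δ × (∀ t → Near δ c t → Near ε (f c) (f t))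

  -- If f has no zero, negativity of f propagates along [A, B] and reaches B, where f is
  -- nonnegative.
  intermediate-value : ∀ f → Continuous f → ∀ {A B} → A ≤ B → f A < 0# → 0# ≤ f B →
    ¬ ¬ (∃ λ x → A ≤ x × x ≤ B × f x ≈ 0#)
  intermediate-value f cont {A} {B} A≤B fA<0 0≤fB no-root =
    real-induction (λ t → f t < 0#) A≤B fA<0 step (≤⇒≯ 0≤fB)
    where
    step : ∀ c → A ≤ c → c ≤ B → ¬ ¬ Propagates (λ t → f t < 0#) A B c
    step c A≤c c≤B k with compare (f c) 0#
    ... | tri≈ _ fc≈0 _ = no-root (c , A≤c , c≤B , fc≈0)
    ... | tri< fc<0 _ _ = let (δ , 0<δ , near) = cont c (- f c) (neg-pos fc<0) in
      k (δ , 0<δ , λ s t _ _ _ _ _ near-t _ →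
        <-cong refl (-‿inverseʳ (f c)) (proj₂ (near t near-t)))
    -- Here the propagation is vacuous: f is positive near c, so no s near c has f s < 0.
    ... | tri> _ _ 0<fc = let (δ , 0<δ , near) = cont c (f c) 0<fc in
      k (δ , 0<δ , λ s t _ _ _ near-s _ _ fs<0 → contradiction fs<0
        (≤⇒≯ (<⇒≤ (<-cong (-‿inverseʳ (f c)) refl (proj₁ (near s near-s))))))

-- The ring of complex numbers and the squared modulus

module ComplexNumbers (R : CompleteOrderedField) where
  open Pisot R
  open OrderedField R

  infix 8 -ᶜ_
  -ᶜ_ : ℂ → ℂ
  -ᶜ z = (- re z) +i (- im z)

  ℂ-commutativeRing : CommutativeRing 0ℓ 0ℓ
  ℂ-commutativeRing = record
    { Carrier = ℂ ; _≈_ = _≈ᶜ_ ; _+_ = _+ᶜ_ ; _*_ = _*ᶜ_ ; -_ = -ᶜ_ ; 0# = 0ᶜ ; 1# = 1ᶜ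
    ; isCommutativeRing = record
      { isRing = record
        { +-isAbelianGroup = record
          { isGroup = record
            { isMonoid = record
              { isSemigroup = record
                { isMagma = record
                  { isEquivalence = record
                    { refl  = refl , refl
                    ; sym   = λ (p , q) → sym p , sym q
                    ; trans = λ (p , q) (r , s) → trans p r , trans q s }
                  ; ∙-cong = λ (p , q) (r , s) → +-cong p r , +-cong q s }
                ; assoc = λ _ _ _ → +-assoc _ _ _ , +-assoc _ _ _ }
              ; identity = (λ _ → +-identityˡ _ , +-identityˡ _)
                         , (λ _ → +-identityʳ _ , +-identityʳ _) }
            ; inverse = (λ _ → -‿inverseˡ _ , -‿inverseˡ _)
                      , (λ _ → -‿inverseʳ _ , -‿inverseʳ _)
            ; ⁻¹-cong = λ (p , q) → -‿cong p , -‿cong q }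
          ; comm = λ _ _ → +-comm _ _ , +-comm _ _ }
        ; *-cong = λ (p , q) (r , s) →
            +-cong (*-cong p r) (-‿cong (*-cong q s)) , +-cong (*-cong p s) (*-cong q r)
        ; *-assoc = λ (a +i b) (c +i d) (e +i f) →
            solve 6 (λ a b c d e f → (a :* c :- b :* d) :* e :- (a :* d :+ b :* c) :* f
                      := a :* (c :* e :- d :* f) :- b :* (c :* f :+ d :* e)) refl a b c d e f
          , solve 6 (λ a b c d e f → (a :* c :- b :* d) :* f :+ (a :* d :+ b :* c) :* e
                      := a :* (c :* f :+ d :* e) :+ b :* (c :* e :- d :* f)) refl a b c d e f
        ; *-identity =
            (λ (a +i b) →
                solve 2 (λ a b → con (+ 1) :* a :- con (+ 0) :* b := a) refl a b
              , solve 2 (λ a b → con (+ 1) :* b :+ con (+ 0) :* a := b) refl a b)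
          , (λ (a +i b) →
                solve 2 (λ a b → a :* con (+ 1) :- b :* con (+ 0) := a) refl a b
              , solve 2 (λ a b → a :* con (+ 0) :+ b :* con (+ 1) := b) refl a b)
        ; distrib =
            (λ (a +i b) (c +i d) (e +i f) →
                solve 6 (λ a b c d e f → a :* (c :+ e) :- b :* (d :+ f)
                  := (a :* c :- b :* d) :+ (a :* e :- b :* f)) refl a b c d e f
              , solve 6 (λ a b c d e f → a :* (d :+ f) :+ b :* (c :+ e)
                  := (a :* d :+ b :* c) :+ (a :* f :+ b :* e)) refl a b c d e f)
          , (λ (a +i b) (c +i d) (e +i f) →
                solve 6 (λ a b c d e f → (c :+ e) :* a :- (d :+ f) :* b
                  := (c :* a :- d :* b) :+ (e :* a :- f :* b)) refl a b c d e f
              , solve 6 (λ a b c d e f → (c :+ e) :* b :+ (d :+ f) :* a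
                  := (c :* b :+ d :* a) :+ (e :* b :+ f :* a)) refl a b c d e f)
        }
      ; *-comm = λ (a +i b) (c +i d) →
            solve 4 (λ a b c d → a :* c :- b :* d := c :* a :- d :* b) refl a b c d
          , solve 4 (λ a b c d → a :* d :+ b :* c := c :* b :+ d :* a) refl a b c d
      }
    }

  module ℂR = CommutativeRing ℂ-commutativeRing
  module ℂS = IntegerCoefficients ℂ-commutativeRing
  open import Algebra.Properties.Semiring.Exp ℂR.semiring public
    using () renaming (_^_ to _^ᶜ_; ^-congˡ to ^ᶜ-congˡ; ^-homo-* to ^ᶜ-homo-+)
  open import Algebra.Properties.CommutativeSemiring.Exp ℂR.commutativeSemiring public
    using () renaming (^-distrib-* to ^ᶜ-distrib-*)

  infixl 6 _-ᶜ_
  _-ᶜ_ : ℂ → ℂ → ℂ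
  z -ᶜ w = z +ᶜ -ᶜ w

  N : ℂ → ℝ
  N z = re z * re z + im z * im z

  -- Re(w̄ z)
  infix 7 _∙_
  _∙_ : ℂ → ℂ → ℝ
  w ∙ z = re w * re z + im w * im z

  N-cong : ∀ {z w} → z ≈ᶜ w → N z ≈ N w
  N-cong (p , q) = +-cong (*-cong p p) (*-cong q q)

  N-* : ∀ z w → N (z *ᶜ w) ≈ N z * N w
  N-* (a +i b) (c +i d) = solve 4 (λ a b c d →
    (a :* c :- b :* d) :* (a :* c :- b :* d) :+ (a :* d :+ b :* c) :* (a :* d :+ b :* c)
      := (a :* a :+ b :* b) :* (c :* c :+ d :* d)) refl a b c d

  0≤N : ∀ z → 0# ≤ N z
  0≤N z = 0≤+ (0≤² (re z)) (0≤² (im z))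

  -- The parallelogram law with the term N (z - w) dropped. It serves as a triangle inequality free
  -- of square roots.
  N-+≤ : ∀ z w → N (z +ᶜ w) ≤ 2# * (N z + N w)
  N-+≤ z@(a +i b) w@(c +i d) = 0≤⇒≤ (0≤N (z -ᶜ w)) (solve 4 (λ a b c d →
    (a :- c) :* (a :- c) :+ (b :- d) :* (b :- d)
      := con (+ 2) :* ((a :* a :+ b :* b) :+ (c :* c :+ d :* d))
        :- ((a :+ c) :* (a :+ c) :+ (b :+ d) :* (b :+ d))) refl a b c d)

  N1≈1 : N 1ᶜ ≈ 1#
  N1≈1 = solve 0 (con (+ 1) :* con (+ 1) :+ con (+ 0) :* con (+ 0) := con (+ 1)) refl

  N0≈0 : N 0ᶜ ≈ 0#
  N0≈0 = solve 0 (con (+ 0) :* con (+ 0) :+ con (+ 0) :* con (+ 0) := con (+ 0)) refl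

  _≟0ᶜ : ∀ z → Dec (z ≈ᶜ 0ᶜ)
  z ≟0ᶜ with compare (re z) 0# | compare (im z) 0#
  ... | tri≈ _ p _   | tri≈ _ q _   = yes (p , q)
  ... | tri< _ ¬p _  | _            = no (¬p ∘ proj₁)
  ... | tri> _ ¬p _  | _            = no (¬p ∘ proj₁)
  ... | tri≈ _ _ _   | tri< _ ¬q _  = no (¬q ∘ proj₂)
  ... | tri≈ _ _ _   | tri> _ ¬q _  = no (¬q ∘ proj₂)

  N-pos : ∀ {z} → ¬ (z ≈ᶜ 0ᶜ) → 0# < N z
  N-pos {z} z≉0 with compare (re z) 0# | compare (im z) 0#
  ... | tri≈ _ p _   | tri≈ _ q _  = contradiction (p , q) z≉0
  ... | tri< _ ¬p _  | _           = 0<+₁ (0<² ¬p) (0≤² (im z))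
  ... | tri> _ ¬p _  | _           = 0<+₁ (0<² ¬p) (0≤² (im z))
  ... | tri≈ _ _ _   | tri< _ ¬q _ = <-cong refl (+-comm _ _) (0<+₁ (0<² ¬q) (0≤² (re z)))
  ... | tri≈ _ _ _   | tri> _ ¬q _ = <-cong refl (+-comm _ _) (0<+₁ (0<² ¬q) (0≤² (re z)))

  N-pos⇒≉0 : ∀ {z} → 0# < N z → ¬ (z ≈ᶜ 0ᶜ)
  N-pos⇒≉0 0<N z≈0 = <-irrefl (<-cong refl (trans (N-cong z≈0) N0≈0) 0<N)

  *ᶜ-≉0 : ∀ {z w} → ¬ (z ≈ᶜ 0ᶜ) → ¬ (w ≈ᶜ 0ᶜ) → ¬ (z *ᶜ w ≈ᶜ 0ᶜ)
  *ᶜ-≉0 {z} {w} z≉0 w≉0 = N-pos⇒≉0 (<-cong refl (sym (N-* z w)) (*-pos (N-pos z≉0) (N-pos w≉0)))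

  -≈0⇒≈ : ∀ {z w} → z -ᶜ w ≈ᶜ 0ᶜ → z ≈ᶜ w
  -≈0⇒≈ {z} {w} z-w≈0 = ℂR.trans
    (ℂS.solve 2 (λ z w → z ℂS.:= (z ℂS.:- w) ℂS.:+ w) ℂR.refl z w)
    (ℂR.trans (ℂR.+-congʳ z-w≈0) (ℂR.+-identityˡ w))

-- Growth and local behaviour of complex polynomials

module ComplexPolynomials (R : CompleteOrderedField) where
  open Pisot R
  open OrderedField R
  open RealInduction R
  open ComplexNumbers R

  evalᶜ : ∀ {n} → Vec ℂ n → ℂ → ℂ
  evalᶜ []       z = 1ᶜ
  evalᶜ (a ∷ as) z = a +ᶜ z *ᶜ evalᶜ as z

  evalᶜ-cong : ∀ {n} (as : Vec ℂ n) {z w} → z ≈ᶜ w → evalᶜ as z ≈ᶜ evalᶜ as w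
  evalᶜ-cong []       z≈w = ℂR.refl
  evalᶜ-cong (a ∷ as) z≈w = ℂR.+-congˡ (ℂR.*-cong z≈w (evalᶜ-cong as z≈w))

  -- Synthetic division by X - w: the coefficients are the intermediate values of Horner's scheme at
  -- w, and the remainder is the value at w.
  quotient : ∀ {n} → Vec ℂ (suc n) → ℂ → Vec ℂ n
  quotient (a ∷ [])         w = []
  quotient (a ∷ as@(_ ∷ _)) w = evalᶜ as w ∷ quotient as w

  eval-quotient : ∀ {n} (as : Vec ℂ (suc n)) w z →
    evalᶜ as z ≈ᶜ evalᶜ as w +ᶜ (z -ᶜ w) *ᶜ evalᶜ (quotient as w) z
  eval-quotient (a ∷ []) w z =
    ℂS.solve 3 (λ a w z → a ℂS.:+ z ℂS.:* ℂS.con (+ 1)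
      ℂS.:= (a ℂS.:+ w ℂS.:* ℂS.con (+ 1)) ℂS.:+ (z ℂS.:- w) ℂS.:* ℂS.con (+ 1)) ℂR.refl a w z
  eval-quotient (a ∷ as@(_ ∷ _)) w z = ℂR.trans
    (ℂR.+-congˡ (ℂR.*-congˡ (eval-quotient as w z)))
    (ℂS.solve 5 (λ a w z p q → a ℂS.:+ z ℂS.:* (p ℂS.:+ (z ℂS.:- w) ℂS.:* q)
      ℂS.:= (a ℂS.:+ w ℂS.:* p) ℂS.:+ (z ℂS.:- w) ℂS.:* (p ℂS.:+ z ℂS.:* q))
      ℂR.refl a w z (evalᶜ as w) (evalᶜ (quotient as w) z))

  -- The difference quotient, defined also at z = w. Degree 0 is separate because its quotient is
  -- the zero polynomial, which is not monic.
  slope : ∀ {n} → Vec ℂ n → ℂ → ℂ → ℂ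
  slope []             w z = 0ᶜ
  slope as@(_ ∷ _)     w z = evalᶜ (quotient as w) z

  eval-slope : ∀ {n} (as : Vec ℂ n) w z →
    evalᶜ as z ≈ᶜ evalᶜ as w +ᶜ (z -ᶜ w) *ᶜ slope as w z
  eval-slope []         w z = ℂS.solve 2 (λ z w →
    ℂS.con (+ 1) ℂS.:= ℂS.con (+ 1) ℂS.:+ (z ℂS.:- w) ℂS.:* ℂS.con (+ 0)) ℂR.refl z w
  eval-slope as@(_ ∷ _) w z = eval-quotient as w z

  eval-bounded : ∀ {n} (as : Vec ℂ n) K → 0# ≤ K →
    ∃ λ M → 0# ≤ M × (∀ z → N z ≤ K → N (evalᶜ as z) ≤ M)
  eval-bounded []       K 0≤K = 1# , <⇒≤ 0<1 , λ _ _ → ≤-reflexive N1≈1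
  eval-bounded (a ∷ as) K 0≤K = let (M , 0≤M , bound) = eval-bounded as K 0≤K in
      2# * (N a + K * M)
    , 0≤* (<⇒≤ 0<2) (0≤+ (0≤N a) (0≤* 0≤K 0≤M))
    , λ z Nz≤K → ≤-trans (N-+≤ a (z *ᶜ evalᶜ as z))
        (≤-cong (*-comm _ _) (*-comm _ _) (*-monoˡ-≤ (<⇒≤ 0<2) (+-mono-≤ ≤-refl
          (≤-trans (≤-reflexive (N-* z (evalᶜ as z)))
            (*-mono-≤ (0≤N _) 0≤K Nz≤K (bound z Nz≤K))))))

  slope-bounded : ∀ {n} (as : Vec ℂ n) w r → 0# ≤ r → ∃ λ M → 0# ≤ M ×
    (∀ z → N (z -ᶜ w) ≤ r → N (slope as w z) ≤ M)
  slope-bounded []         w r 0≤r = 0# , ≤-refl , λ _ _ → ≤-reflexive N0≈0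
  slope-bounded as@(_ ∷ _) w r 0≤r =
    let K = 2# * (r + N w)
        0≤K = 0≤* (<⇒≤ 0<2) (0≤+ 0≤r (0≤N w))
        (M , 0≤M , bound) = eval-bounded (quotient as w) K 0≤K
    in M , 0≤M , λ z Nz-w≤r → bound z (≤-trans
         (≤-reflexive (N-cong (ℂS.solve 2 (λ z w → z ℂS.:= (z ℂS.:- w) ℂS.:+ w) ℂR.refl z w)))
         (≤-trans (N-+≤ (z -ᶜ w) w)
           (≤-cong (*-comm _ _) (*-comm _ _) (*-monoˡ-≤ (<⇒≤ 0<2) (+-mono-≤ Nz-w≤r ≤-refl)))))

  -- A reverse triangle inequality: the difference of the two sides is N (z + 2w).
  N≤2*N+ : ∀ z w → N z ≤ 2# * (N (z +ᶜ w) + N w)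
  N≤2*N+ (a +i b) (c +i d) = 0≤⇒≤ (0≤N ((a + (c + c)) +i (b + (d + d)))) (solve 4 (λ a b c d →
    (a :+ (c :+ c)) :* (a :+ (c :+ c)) :+ (b :+ (d :+ d)) :* (b :+ (d :+ d))
      := con (+ 2) :* (((a :+ c) :* (a :+ c) :+ (b :+ d) :* (b :+ d)) :+ (c :* c :+ d :* d))
        :- (a :* a :+ b :* b)) refl a b c d)

  mutual
    eval-≥1 : ∀ {n} (as : Vec ℂ n) →
      ∃ λ K → 0# ≤ K × (∀ z → K ≤ N z → 1# ≤ N (evalᶜ as z))
    eval-≥1 []          = 0# , ≤-refl , λ _ _ → ≤-reflexive (sym N1≈1)
    eval-≥1 as@(_ ∷ _)  = eval-coercive as 1# (<⇒≤ 0<1)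

    -- For P = a + z Q with N (Q z) ≥ 1 one has N (z Q) ≥ N z, so N z ≥ 2 (M + N a) forces N P ≥ M
    -- by the reverse triangle inequality. The recursion asks for the lower bound 1 only, which also
    -- holds for the constant polynomial 1.
    eval-coercive : ∀ {n} (as : Vec ℂ (suc n)) M → 0# ≤ M →
      ∃ λ K → 0# ≤ K × (∀ z → K ≤ N z → M ≤ N (evalᶜ as z))
    eval-coercive (a ∷ as) M 0≤M =
      let (K , 0≤K , lower) = eval-≥1 as
          L = 2# * (M + N a)
          0≤L = 0≤* (<⇒≤ 0<2) (0≤+ 0≤M (0≤N a))
      in K + L , 0≤+ 0≤K 0≤L , λ z K+L≤Nz →
        let u = z *ᶜ evalᶜ as z
            K≤Nz = ≤-trans (0≤⇒≤ 0≤L (solve 2 (λ k l → l := (k :+ l) :- k) refl K L)) K+L≤Nz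
            L≤Nz = ≤-trans (0≤⇒≤ 0≤K (solve 2 (λ k l → k := (k :+ l) :- l) refl K L)) K+L≤Nz
            Nz≤Nu = ≤-trans (≤-reflexive (sym (*-identityʳ (N z))))
                      (≤-trans (*-mono-≤ (<⇒≤ 0<1) (0≤N z) ≤-refl (lower z K≤Nz))
                        (≤-reflexive (sym (N-* z (evalᶜ as z)))))
            L≤ = ≤-trans L≤Nz (≤-trans Nz≤Nu (≤-trans (N≤2*N+ u a)
                   (≤-reflexive (*-congˡ (+-congʳ (N-cong (ℂR.+-comm u a)))))))
        in ≮⇒≥ λ N<M → ≤⇒≯ L≤ (0<⇒< (*-pos 0<2 (<⇒0<- N<M))
             (solve 3 (λ m n a → con (+ 2) :* (m :- n)
               := con (+ 2) :* (m :+ a) :- con (+ 2) :* (n :+ a)) refl M (N (a +ᶜ u)) (N a)))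

  -- Factors z - w are split off until the cofactor no longer vanishes at w. This ends because the
  -- last cofactor is the constant 1. The order of vanishing of P - P(w) at w is k + 1.
  first-nonzero-term : ∀ {n} (as : Vec ℂ (suc n)) w → ∃ λ k → ∃₂ λ m (bs : Vec ℂ m) →
    ¬ (evalᶜ bs w ≈ᶜ 0ᶜ) ×
    (∀ z → evalᶜ as z ≈ᶜ evalᶜ as w +ᶜ (z -ᶜ w) ^ᶜ suc k *ᶜ evalᶜ bs z)
  first-nonzero-term {n} as w with evalᶜ (quotient as w) w ≟0ᶜ
  ... | no q≉0 = 0 , n , quotient as w , q≉0 , λ z → ℂR.trans (eval-quotient as w z)
    (ℂR.+-congˡ (ℂR.*-congʳ (ℂR.sym (ℂR.*-identityʳ _))))
  first-nonzero-term {zero} (a ∷ []) w | yes 1≈0 =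
    contradiction 1≈0 (N-pos⇒≉0 (<-cong refl (sym N1≈1) 0<1))
  first-nonzero-term {suc n} as w | yes q≈0 =
    let (k , m , bs , bs≉0 , expand) = first-nonzero-term (quotient as w) w in
    suc k , m , bs , bs≉0 , λ z → ℂR.trans (eval-quotient as w z) (ℂR.+-congˡ
      (ℂR.trans (ℂR.*-congˡ (ℂR.trans (expand z) (ℂR.trans (ℂR.+-congʳ q≈0) (ℂR.+-identityˡ _))))
        (ℂR.sym (ℂR.*-assoc _ _ _))))

  -- The witness t = β / (β + C) needs no case distinction on C = 0.
  scale-down : ∀ {β C} → 0# < β → 0# ≤ C → ∃ λ t → 0# < t × t ≤ 1# × t * C ≤ β
  scale-down {β} {C} 0<β 0≤C =
    let d = β + C
        0<d = 0<+₁ 0<β 0≤C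
        t = β * d ⁻¹
        td≈β = trans (*-assoc _ _ _) (trans (*-congˡ (trans (*-comm _ _) (*-inverseʳ d (>⇒≉ 0<d)))) (*-identityʳ β))
        0<t = *-pos 0<β (⁻¹-pos 0<d)
    in t , 0<t
     , *-cancelʳ-≤ 0<d (≤-trans (≤-reflexive td≈β) (≤-trans
         (0≤⇒≤ 0≤C (solve 2 (λ b c → c := (b :+ c) :- b) refl β C))
         (≤-reflexive (sym (*-identityˡ d)))))
     , ≤-trans (0≤⇒≤ (<⇒≤ (*-pos 0<t 0<β))
         (solve 3 (λ t b c → t :* b := t :* (b :+ c) :- t :* c) refl t β C))
         (≤-reflexive td≈β)

  -- With P(z) = A + u, the cross term is controlled by the weighted inequality 2 A∙u ≥ -(s N A + N
  -- u / s), that is N (sA + u) ≥ 0. Everything is multiplied by s to avoid the division.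
  eval-lower-semicontinuous : ∀ {n} (as : Vec ℂ n) w μ → μ < N (evalᶜ as w) →
    ∃ λ ρ → 0# < ρ × ∃ λ η → 0# < η × (∀ z → N (z -ᶜ w) ≤ ρ → μ + η ≤ N (evalᶜ as z))
  eval-lower-semicontinuous as w μ μ<A =
    let A = evalᶜ as w
        a = N A
        -- A quarter of the gap: the errors s N A and N u / s cost at most h each, so N P stays
        -- above a - 2h = μ + 2h.
        h = half (half (a - μ))
        0<h = half-pos (half-pos (<⇒0<- μ<A))
        4h≈ : h + h + (h + h) ≈ a - μ
        4h≈ = trans (+-cong (half+half _) (half+half _)) (half+half _)
        (s , 0<s , s≤1 , sa≤h) = scale-down 0<h (0≤N A)
        (M , 0≤M , bound) = slope-bounded as w 1# (<⇒≤ 0<1)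
        (ρ , 0<ρ , ρ≤1 , ρM≤sh) = scale-down (*-pos 0<s 0<h) 0≤M
    in ρ , 0<ρ , h + h , 0<+ 0<h 0<h , λ z Nz-w≤ρ →
      let u = (z -ᶜ w) *ᶜ slope as w z
          Nu≤sh = ≤-trans (≤-reflexive (N-* (z -ᶜ w) (slope as w z)))
            (≤-trans (*-mono-≤ (0≤N (slope as w z)) (<⇒≤ 0<ρ) Nz-w≤ρ (bound z (≤-trans Nz-w≤ρ ρ≤1))) ρM≤sh)
      in *-cancelʳ-≤ 0<s (0≤⇒≤
        (0≤+ (0≤+ (0≤+ (0≤N (ofReal s *ᶜ A +ᶜ u)) (0≤* (<⇒≤ 0<s) (≤⇒0≤- sa≤h))) (≤⇒0≤- Nu≤sh))
             (0≤* (<⇒≤ 0<s) (0≤N u)))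
        (trans (solve 6 (λ p q x y s h →
           (((s :* p :- con (+ 0) :* q :+ x) :* (s :* p :- con (+ 0) :* q :+ x)
             :+ (s :* q :+ con (+ 0) :* p :+ y) :* (s :* q :+ con (+ 0) :* p :+ y))
             :+ s :* (h :- s :* (p :* p :+ q :* q)) :+ (s :* h :- (x :* x :+ y :* y)))
             :+ s :* (x :* x :+ y :* y)
           := ((p :+ x) :* (p :+ x) :+ (q :+ y) :* (q :+ y)) :* s
             :- (((p :* p :+ q :* q) :- (h :+ h :+ (h :+ h))) :+ (h :+ h)) :* s)
           refl (re A) (im A) (re u) (im u) s h)
         (+-cong (*-congʳ (N-cong (ℂR.sym (eval-slope as w z))))
           (-‿cong (*-congʳ (+-congʳ (trans (+-congˡ (-‿cong 4h≈))
             (solve 2 (λ a m → a :- (a :- m) := m) refl a μ))))))))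

  ofReal-* : ∀ x y → ofReal (x * y) ≈ᶜ ofReal x *ᶜ ofReal y
  ofReal-* x y =
      solve 2 (λ x y → x :* y := x :* y :- con (+ 0) :* con (+ 0)) refl x y
    , solve 2 (λ x y → con (+ 0) := x :* con (+ 0) :+ con (+ 0) :* y) refl x y

  ofReal-^ : ∀ {t} → 0# < t → t ≤ 1# → ∀ k →
    ∃ λ τ → 0# < τ × τ ≤ t × ofReal t ^ᶜ suc k ≈ᶜ ofReal τ
  ofReal-^ {t} 0<t t≤1 zero    = t , 0<t , ≤-refl , ℂR.*-identityʳ _
  ofReal-^ {t} 0<t t≤1 (suc k) = let (τ , 0<τ , τ≤t , eq) = ofReal-^ 0<t t≤1 k in
      t * τ , *-pos 0<t 0<τ
    , ≤-trans (*-mono-≤ (<⇒≤ 0<τ) (<⇒≤ 0<t) ≤-refl (≤-trans τ≤t t≤1)) (≤-reflexive (*-identityʳ t))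
    , ℂR.trans (ℂR.*-congˡ eq) (ℂR.sym (ofReal-* t τ))

  -- With v = b + t s, expanding gives N A - N (A + τ v) = τ (2β - 2t A∙s - τ N v), where β =
  -- -(A∙b), and a small t keeps the bracket positive. The number t is fixed before τ and s, since
  -- in the application τ is a power of t and s is evaluated at a point depending on t.
  perturb-smaller : ∀ A b S → A ∙ b < 0# → 0# ≤ S → ∃ λ t → 0# < t × t ≤ 1# ×
    (∀ τ s → 0# < τ → τ ≤ t → N s ≤ S → N (A +ᶜ ofReal τ *ᶜ (b +ᶜ ofReal t *ᶜ s)) < N A)
  perturb-smaller A b S Ab<0 0≤S =
    let β = - (A ∙ b)
        0<β = neg-pos Ab<0
        -- N A + S bounds 2 A∙s, and the last summand bounds N v.
        C = N A + S + 2# * (N b + S)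
        0≤C = 0≤+ (0≤+ (0≤N A) 0≤S) (0≤* (<⇒≤ 0<2) (0≤+ (0≤N b) 0≤S))
        (t , 0<t , t≤1 , tC≤β) = scale-down 0<β 0≤C
        0≤t = <⇒≤ 0<t
        t²≤1 = ≤-trans (*-mono-≤ 0≤t (<⇒≤ 0<1) t≤1 t≤1) (≤-reflexive (*-identityʳ 1#))
    in t , 0<t , t≤1 , λ τ s 0<τ τ≤t Ns≤S →
      let v = b +ᶜ ofReal t *ᶜ s
          Nts≤S = ≤-trans (≤-reflexive (solve 3 (λ t x y →
                    (t :* x :- con (+ 0) :* y) :* (t :* x :- con (+ 0) :* y)
                    :+ (t :* y :+ con (+ 0) :* x) :* (t :* y :+ con (+ 0) :* x)
                    := t :* t :* (x :* x :+ y :* y)) refl t (re s) (im s)))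
                  (≤-trans (*-mono-≤ (0≤N s) (<⇒≤ 0<1) t²≤1 Ns≤S) (≤-reflexive (*-identityˡ S)))
          Nv≤ : N v ≤ 2# * (N b + S)
          Nv≤ = ≤-trans (N-+≤ b (ofReal t *ᶜ s))
                  (≤-cong (*-comm _ _) (*-comm _ _) (*-monoˡ-≤ (<⇒≤ 0<2) (+-mono-≤ ≤-refl Nts≤S)))
          D = 2# * (N b + S)
          0≤Nv = 0≤N v
          τNv≤tD : τ * N v ≤ t * D
          τNv≤tD = *-mono-≤ 0≤Nv 0≤t τ≤t Nv≤
          gain : 0# < β + (β - t * C) + t * (S - N s) + t * N (A -ᶜ s) + (t * D - τ * N v)
          gain = 0<+₁ (0<+₁ (0<+₁ (0<+₁ 0<β (≤⇒0≤- tC≤β)) (0≤* 0≤t (≤⇒0≤- Ns≤S)))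
                   (0≤* 0≤t (0≤N (A -ᶜ s)))) (≤⇒0≤- τNv≤tD)
      in 0<⇒< (*-pos 0<τ gain)
        (solve 10 (λ p q x y u w t τ S nb →
          let β  = :- (p :* x :+ q :* y)
              v₁ = x :+ (t :* u :- con (+ 0) :* w)
              v₂ = y :+ (t :* w :+ con (+ 0) :* u)
              NA = p :* p :+ q :* q
              Ns = u :* u :+ w :* w
              Nv = v₁ :* v₁ :+ v₂ :* v₂
              D  = con (+ 2) :* (nb :+ S)
              z₁ = p :+ (τ :* v₁ :- con (+ 0) :* v₂)
              z₂ = q :+ (τ :* v₂ :+ con (+ 0) :* v₁)
          in τ :* (β :+ (β :- t :* (NA :+ S :+ D)) :+ t :* (S :- Ns)
                :+ t :* ((p :- u) :* (p :- u) :+ (q :- w) :* (q :- w)) :+ (t :* D :- τ :* Nv))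
             := NA :- (z₁ :* z₁ :+ z₂ :* z₂))
          refl (re A) (im A) (re b) (im b) (re s) (im s) t τ S (N b))

-- Square roots, descent directions and the fundamental theorem of algebra

module AlgebraicClosure (R : CompleteOrderedField) where
  open Pisot R
  open OrderedField R
  open RealInduction R
  open ComplexNumbers R
  open ComplexPolynomials R
  open import Relation.Binary.Reasoning.Setoid setoid

  near⇒² : ∀ {δ c t} → Near δ c t → (t - c) * (t - c) < δ * δ
  near⇒² {δ} {c} {t} (l , u) = 0<⇒< (*-pos (<⇒0<- l) (<⇒0<- u))
    (solve 3 (λ d c t → (t :- (c :- d)) :* (c :+ d :- t)
      := d :* d :- (t :- c) :* (t :- c)) refl δ c t)

  ²⇒near : ∀ {δ c t} → 0# < δ → (t - c) * (t - c) < δ * δ → Near δ c t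
  ²⇒near {δ} {c} {t} 0<δ lt =
      ≰⇒> (λ t≤ → ≤⇒≯ (0≤⇒≤ (0≤* (≤⇒0≤- t≤) (0≤+ (≤⇒0≤- t≤) 0≤δ+δ))
        (solve 3 (λ d c t → (c :- d :- t) :* (c :- d :- t :+ (d :+ d))
          := (t :- c) :* (t :- c) :- d :* d) refl δ c t)) lt)
    , ≰⇒> (λ t≥ → ≤⇒≯ (0≤⇒≤ (0≤* (≤⇒0≤- t≥) (0≤+ (≤⇒0≤- t≥) 0≤δ+δ))
        (solve 3 (λ d c t → (t :- (c :+ d)) :* (t :- (c :+ d) :+ (d :+ d))
          := (t :- c) :* (t :- c) :- d :* d) refl δ c t)) lt)
    where 0≤δ+δ = <⇒≤ (0<+ 0<δ 0<δ)

  evalʳ : ∀ {n} → Vec ℝ n → ℝ → ℝ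
  evalʳ []       x = 1#
  evalʳ (a ∷ as) x = a + x * evalʳ as x

  evalᶜ-ofReal : ∀ {n} (as : Vec ℝ n) x → evalᶜ (map ofReal as) (ofReal x) ≈ᶜ ofReal (evalʳ as x)
  evalᶜ-ofReal []       x = ℂR.refl
  evalᶜ-ofReal (a ∷ as) x = ℂR.trans
    (ℂR.+-congˡ (ℂR.trans (ℂR.*-congˡ (evalᶜ-ofReal as x)) (ℂR.sym (ofReal-* x _))))
    (refl , +-identityʳ 0#)

  N-ofReal : ∀ x → N (ofReal x) ≈ x * x
  N-ofReal x = solve 1 (λ x → x :* x :+ con (+ 0) :* con (+ 0) := x :* x) refl x

  -- The real polynomial is viewed over ℂ, so that the bound on `slope` applies: (f t - f c)² = (t -
  -- c)² N S.
  evalʳ-continuous : ∀ {n} (as : Vec ℝ n) → Continuous (evalʳ as)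
  evalʳ-continuous as c ε 0<ε =
    let (M , 0≤M , bound) = slope-bounded (map ofReal as) (ofReal c) 1# (<⇒≤ 0<1)
        -- Scaling against M + 1 instead of M leaves the strict inequality δ M < δ (M + 1) ≤ ε².
        -- From δ ≤ 1 comes δ² ≤ δ.
        (δ , 0<δ , δ≤1 , δM≤) = scale-down (*-pos 0<ε 0<ε) (0≤+ 0≤M (<⇒≤ 0<1))
        δδ≤1 = ≤-trans (*-mono-≤ (<⇒≤ 0<δ) (<⇒≤ 0<1) δ≤1 δ≤1) (≤-reflexive (*-identityʳ 1#))
    in δ , 0<δ , λ t near →
      let f = evalʳ as
          P = evalᶜ (map ofReal as)
          D = ofReal t -ᶜ ofReal c
          S = slope (map ofReal as) (ofReal c) (ofReal t)
          ND≈ : N D ≈ (t - c) * (t - c)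
          ND≈ = trans (N-cong {D} {ofReal (t - c)} (refl , -‿inverseʳ 0#)) (N-ofReal (t - c))
          ND<δδ = <-cong (sym ND≈) refl (near⇒² near)
          diff : P (ofReal t) -ᶜ P (ofReal c) ≈ᶜ D *ᶜ S
          diff = ℂR.trans (ℂR.+-congʳ (eval-slope (map ofReal as) (ofReal c) (ofReal t)))
            (ℂS.solve 2 (λ p d → (p ℂS.:+ d) ℂS.:- p ℂS.:= d) ℂR.refl (P (ofReal c)) (D *ᶜ S))
          square : (f t - f c) * (f t - f c) ≈ N D * N S
          square = trans (sym (N-ofReal (f t - f c))) (trans
            (N-cong {ofReal (f t - f c)} {D *ᶜ S} (ℂR.trans
              (ℂR.trans (refl , sym (-‿inverseʳ 0#))
                (ℂR.+-cong (ℂR.sym (evalᶜ-ofReal as t)) (ℂR.-‿cong (ℂR.sym (evalᶜ-ofReal as c)))))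
              diff))
            (N-* D S))
          NDNS≤ : N D * N S ≤ δ * M
          NDNS≤ = *-mono-≤ (0≤N S) (<⇒≤ 0<δ)
            (≤-trans (<⇒≤ ND<δδ) (≤-trans (*-mono-≤ (<⇒≤ 0<δ) (<⇒≤ 0<δ) ≤-refl δ≤1)
              (≤-reflexive (*-identityʳ δ))))
            (bound (ofReal t) (≤-trans (<⇒≤ ND<δδ) δδ≤1))
      in ²⇒near 0<ε (<-cong (sym square) refl (≤-<-trans NDNS≤ (<-≤-trans
           (0<⇒< 0<δ (solve 2 (λ d m → d := d :* (m :+ con (+ 1)) :- d :* m) refl δ M)) δM≤)))

  real-sqrt : ∀ {x} → 0# ≤ x → ¬ ¬ (∃ λ s → 0# ≤ s × s * s ≈ x)
  real-sqrt (inj₂ 0≈x) k = k (0# , ≤-refl , trans (zeroˡ 0#) 0≈x)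
  real-sqrt {x} (inj₁ 0<x) k = intermediate-value (evalʳ as) (evalʳ-continuous as)
    -- At the endpoint 1 + x the polynomial X² - x has the value 1 + x + x².
    {0#} {1# + x} 0≤1+x
    (0<⇒< 0<x (solve 1 (λ x → x := con (+ 0)
      :- (:- x :+ con (+ 0) :* (con (+ 0) :+ con (+ 0) :* con (+ 1)))) refl x))
    (0≤⇒≤ (0≤+ 0≤1+x (0≤² x)) (solve 1 (λ x → (con (+ 1) :+ x) :+ x :* x
      := (:- x :+ (con (+ 1) :+ x) :* (con (+ 0) :+ (con (+ 1) :+ x) :* con (+ 1))) :- con (+ 0)) refl x))
    λ (s , 0≤s , _ , fs≈0) → k (s , 0≤s , trans
      (solve 2 (λ s x → s :* s := (:- x :+ s :* (con (+ 0) :+ s :* con (+ 1))) :+ x) refl s x)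
      (trans (+-congʳ fs≈0) (+-identityˡ x)))
    where
    as = - x ∷ 0# ∷ []
    0≤1+x = 0≤+ (<⇒≤ 0<1) (<⇒≤ 0<x)

  private
    opposite : ∀ {x y} → x * x ≈ y * y → ¬ (x - y ≈ 0#) → x ≈ - y
    opposite {x} {y} xx≈yy x-y≉0 = trans (solve 2 (λ x y → x := (x :+ y) :- y) refl x y)
      (trans (+-congʳ (*-cancelˡ-≈0 x-y≉0 (trans
        (solve 2 (λ x y → (x :- y) :* (x :+ y) := x :* x :- y :* y) refl x y)
        (trans (+-congʳ xx≈yy) (-‿inverseʳ _))))) (+-identityˡ _))

  ±-of-equal-squares : ∀ {x y} → x * x ≈ y * y → x ≈ y ⊎ x ≈ - y
  ±-of-equal-squares {x} {y} xx≈yy with compare (x - y) 0#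
  ... | tri≈ _ x-y≈0 _ = inj₁ (trans (solve 2 (λ x y → x := (x :- y) :+ y) refl x y)
                            (trans (+-congʳ x-y≈0) (+-identityˡ y)))
  ... | tri< _ x-y≉0 _ = inj₂ (opposite xx≈yy x-y≉0)
  ... | tri> _ x-y≉0 _ = inj₂ (opposite xx≈yy x-y≉0)

  -- The half-angle formulas: with r = |z|, take s² = (r + a)/2 and t² = (r - a)/2. Then s² - t² = a
  -- and (2st)² = b², and the sign of t is chosen to match b.
  complex-sqrt : ∀ z → ¬ ¬ (∃ λ w → w *ᶜ w ≈ᶜ z)
  complex-sqrt z@(a +i b) k =
    real-sqrt (0≤N z) λ (r , 0≤r , rr≈) →
    let a≤r = ²-cancel-≤ 0≤r (0≤⇒≤ (0≤² b) (trans
                (solve 2 (λ a b → b :* b := (a :* a :+ b :* b) :- a :* a) refl a b)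
                (+-congʳ (sym rr≈))))
        -a≤r = ²-cancel-≤ 0≤r (0≤⇒≤ (0≤² b) (trans
                (solve 2 (λ a b → b :* b := (a :* a :+ b :* b) :- (:- a) :* (:- a)) refl a b)
                (+-congʳ (sym rr≈))))
    in real-sqrt (half-nonneg (≤-cong refl (+-congˡ (-‿involutive a)) (≤⇒0≤- -a≤r))) λ (s , 0≤s , ss≈) →
       real-sqrt (half-nonneg (≤⇒0≤- a≤r)) λ (t , 0≤t , tt≈) →
    let x = half (r + a)
        y = half (r - a)
        re-eq : s * s - t * t ≈ a
        re-eq = begin
          s * s - t * t ≈⟨ +-cong ss≈ (-‿cong tt≈) ⟩
          x - y         ≈⟨ solve 3 (λ r a h → (r :+ a) :* h :- (r :- a) :* h := a :* h :+ a :* h) refl r a (2# ⁻¹) ⟩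
          half a + half a ≈⟨ half+half a ⟩
          a             ∎
        u = s * t + t * s
        uu≈bb : u * u ≈ b * b
        uu≈bb = begin
          u * u                             ≈⟨ solve 2 (λ s t → (s :* t :+ t :* s) :* (s :* t :+ t :* s)
                                                 := (s :* s :+ s :* s) :* (t :* t :+ t :* t)) refl s t ⟩
          (s * s + s * s) * (t * t + t * t) ≈⟨ *-cong (+-cong ss≈ ss≈) (+-cong tt≈ tt≈) ⟩
          (x + x) * (y + y)                 ≈⟨ *-cong (half+half _) (half+half _) ⟩
          (r + a) * (r - a)                 ≈⟨ solve 2 (λ r a → (r :+ a) :* (r :- a) := r :* r :- a :* a) refl r a ⟩
          r * r - a * a                     ≈⟨ +-congʳ rr≈ ⟩
          a * a + b * b - a * a             ≈⟨ solve 2 (λ a b → a :* a :+ b :* b :- a :* a := b :* b) refl a b ⟩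
          b * b                             ∎
    in case ±-of-equal-squares uu≈bb of λ
      { (inj₁ u≈b)  → k (s +i t , re-eq , u≈b)
      ; (inj₂ u≈-b) → k (s +i (- t)
          , trans (+-congˡ (-‿cong (solve 1 (λ t → (:- t) :* (:- t) := t :* t) refl t))) re-eq
          , trans (solve 2 (λ s t → s :* (:- t) :+ (:- t) :* s := :- (s :* t :+ t :* s)) refl s t)
              (trans (-‿cong u≈-b) (-‿involutive b))) }

  private
    parity : ∀ n → (∃ λ j → n ≡ j ℕ.+ j) ⊎ (∃ λ j → n ≡ suc (j ℕ.+ j))
    parity zero = inj₁ (0 , ≡.refl)
    parity (suc n) with parity n
    ... | inj₁ (j , eq) = inj₂ (j , ≡.cong suc eq)
    ... | inj₂ (j , eq) = inj₁ (suc j , ≡.cong suc (≡.trans eq (≡.sym (ℕ.+-suc j j))))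

  iᶜ : ℂ
  iᶜ = 0# +i 1#

  ∙-cong : ∀ A {z w} → z ≈ᶜ w → A ∙ z ≈ A ∙ w
  ∙-cong A (p , q) = +-cong (*-congˡ p) (*-congˡ q)

  ^ᶜ-double : ∀ z j → z ^ᶜ (j ℕ.+ j) ≈ᶜ (z *ᶜ z) ^ᶜ j
  ^ᶜ-double z j = ℂR.trans (^ᶜ-homo-+ z j j) (ℂR.sym (^ᶜ-distrib-* z z j))

  ±1-^ : ∀ {z} → z ≈ᶜ 1ᶜ ⊎ z ≈ᶜ -ᶜ 1ᶜ → ∀ j → z ^ᶜ j ≈ᶜ 1ᶜ ⊎ z ^ᶜ j ≈ᶜ -ᶜ 1ᶜ
  ±1-^ z≈ zero = inj₁ ℂR.refl
  ±1-^ z≈ (suc j) with z≈ | ±1-^ z≈ j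
  ... | inj₁ p | inj₁ q = inj₁ (ℂR.trans (ℂR.*-cong p q) (ℂR.*-identityˡ _))
  ... | inj₁ p | inj₂ q = inj₂ (ℂR.trans (ℂR.*-cong p q) (ℂR.*-identityˡ _))
  ... | inj₂ p | inj₁ q = inj₂ (ℂR.trans (ℂR.*-cong p q) (ℂR.*-identityʳ _))
  ... | inj₂ p | inj₂ q = inj₁ (ℂR.trans (ℂR.*-cong p q)
          (ℂS.solve 0 ((ℂS.:- ℂS.con (+ 1)) ℂS.:* (ℂS.:- ℂS.con (+ 1)) ℂS.:= ℂS.con (+ 1)) ℂR.refl))

  neg-^-odd : ∀ z j → (-ᶜ z) ^ᶜ suc (j ℕ.+ j) ≈ᶜ -ᶜ (z ^ᶜ suc (j ℕ.+ j))
  neg-^-odd z j = ℂR.trans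
    (ℂR.*-congˡ (ℂR.trans (^ᶜ-double (-ᶜ z) j) (ℂR.trans
      (^ᶜ-congˡ j (ℂS.solve 1 (λ z → (ℂS.:- z) ℂS.:* (ℂS.:- z) ℂS.:= z ℂS.:* z) ℂR.refl z))
      (ℂR.sym (^ᶜ-double z j)))))
    (ℂS.solve 2 (λ z p → (ℂS.:- z) ℂS.:* p ℂS.:= ℂS.:- (z ℂS.:* p)) ℂR.refl z (z ^ᶜ (j ℕ.+ j)))

  -- If P(w + tζ) = A + tⁿ ζⁿ c + ..., the leading change of |P|² is 2 tⁿ (A ∙ ζⁿ c). Only its sign
  -- matters, so ζⁿ c need not point exactly opposite to A.
  HasDescentDirection : ℕ → Set
  HasDescentDirection n = ∀ A c → ¬ (A ≈ᶜ 0ᶜ) → ¬ (c ≈ᶜ 0ᶜ) →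
    ¬ ¬ (∃ λ ζ → A ∙ (ζ ^ᶜ n *ᶜ c) < 0#)

  -- For odd n the value changes sign with ζ, so if it is never negative it is always zero. Taking 1
  -- and ±i for ζ makes A orthogonal to both c and ic, while N A N c = (A∙c)² + (A∙ic)² is positive.
  odd-descent : ∀ j → HasDescentDirection (suc (j ℕ.+ j))
  odd-descent j A c A≉0 c≉0 k = not-orthogonal (c-orthogonal)
    where
    n = suc (j ℕ.+ j)
    value : ℂ → ℝ
    value ζ = A ∙ (ζ ^ᶜ n *ᶜ c)
    value-neg : ∀ ζ → value (-ᶜ ζ) ≈ - value ζ
    value-neg ζ = trans
      (∙-cong A (ℂR.trans (ℂR.*-congʳ (neg-^-odd ζ j))
        (ℂS.solve 2 (λ z c → (ℂS.:- z) ℂS.:* c ℂS.:= ℂS.:- (z ℂS.:* c)) ℂR.refl (ζ ^ᶜ n) c)))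
      (solve 4 (λ a b x y → a :* (:- x) :+ b :* (:- y) := :- (a :* x :+ b :* y)) refl
        (re A) (im A) (re (ζ ^ᶜ n *ᶜ c)) (im (ζ ^ᶜ n *ᶜ c)))
    value≈0 : ∀ ζ → value ζ ≈ 0#
    value≈0 ζ with compare (value ζ) 0#
    ... | tri< v<0 _ _ = ⊥-elim (k (ζ , v<0))
    ... | tri≈ _ v≈0 _ = v≈0
    ... | tri> _ _ 0<v = ⊥-elim (k (-ᶜ ζ , <-cong (sym (value-neg ζ)) (-‿inverseˡ _)
                           (<-cong (+-identityʳ _) refl (+-monoʳ-< (- value ζ) 0<v))))
    c-orthogonal : A ∙ c ≈ 0#
    c-orthogonal = trans (∙-cong A (ℂR.sym (ℂR.trans (ℂR.*-congʳ (1^ᶜ n)) (ℂR.*-identityˡ c)))) (value≈0 1ᶜ)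
      where
      1^ᶜ : ∀ m → 1ᶜ ^ᶜ m ≈ᶜ 1ᶜ
      1^ᶜ zero    = ℂR.refl
      1^ᶜ (suc m) = ℂR.trans (ℂR.*-identityˡ _) (1^ᶜ m)
    i²≈-1 : iᶜ *ᶜ iᶜ ≈ᶜ -ᶜ 1ᶜ
    i²≈-1 = solve 0 (con (+ 0) :* con (+ 0) :- con (+ 1) :* con (+ 1) := :- con (+ 1)) refl
          , solve 0 (con (+ 0) :* con (+ 1) :+ con (+ 1) :* con (+ 0) := :- con (+ 0)) refl
    ic≈0 : A ∙ (iᶜ *ᶜ c) ≈ 0#
    ic≈0 with ±1-^ (inj₂ i²≈-1) j
    ... | inj₁ p = trans (∙-cong A (ℂR.*-congʳ (ℂR.sym (ℂR.trans (ℂR.*-congˡ (ℂR.trans (^ᶜ-double iᶜ j) p))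
                     (ℂR.*-identityʳ iᶜ))))) (value≈0 iᶜ)
    ... | inj₂ p = trans (∙-cong A (ℂR.*-congʳ (ℂR.sym (ℂR.trans (neg-^-odd iᶜ j)
                     (ℂR.trans (ℂR.-‿cong (ℂR.*-congˡ (ℂR.trans (^ᶜ-double iᶜ j) p)))
                       (ℂS.solve 1 (λ z → ℂS.:- (z ℂS.:* (ℂS.:- ℂS.con (+ 1))) ℂS.:= z) ℂR.refl iᶜ))))))
                     (value≈0 (-ᶜ iᶜ))
    not-orthogonal : A ∙ c ≈ 0# → ⊥
    not-orthogonal Ac≈0 = <-irrefl (<-cong refl (trans
      (solve 4 (λ a b x y → (a :* a :+ b :* b) :* (x :* x :+ y :* y)
        := (a :* x :+ b :* y) :* (a :* x :+ b :* y)
        :+ (a :* (con (+ 0) :* x :- con (+ 1) :* y) :+ b :* (con (+ 0) :* y :+ con (+ 1) :* x))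
        :* (a :* (con (+ 0) :* x :- con (+ 1) :* y) :+ b :* (con (+ 0) :* y :+ con (+ 1) :* x)))
        refl (re A) (im A) (re c) (im c))
      (trans (+-cong (*-cong Ac≈0 Ac≈0) (*-cong ic≈0 ic≈0))
        (solve 0 (con (+ 0) :* con (+ 0) :+ con (+ 0) :* con (+ 0) := con (+ 0)) refl)))
      (*-pos (N-pos A≉0) (N-pos c≉0)))

  -- For n = 2j the square root of a direction for j is a direction for n, so halving leads down to
  -- odd exponents.
  descent-direction : ∀ n → 0 ℕ.< n → HasDescentDirection n
  descent-direction = <-rec _ λ n rec 0<n → case parity n of λ
    { (inj₂ (j , ≡.refl)) → odd-descent j
    ; (inj₁ (suc j , ≡.refl)) → λ A c A≉0 c≉0 k →
        rec {suc j} (ℕ.m<m+n (suc j) (ℕ.s≤s ℕ.z≤n)) (ℕ.s≤s ℕ.z≤n) A c A≉0 c≉0 λ (η , lt) →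
        complex-sqrt η λ (ζ , ζζ≈η) →
        k (ζ , <-cong (∙-cong A (ℂR.*-congʳ (ℂR.sym (ℂR.trans (^ᶜ-double ζ (suc j))
                 (^ᶜ-congˡ (suc j) ζζ≈η))))) refl lt)
    ; (inj₁ (zero , ≡.refl)) → contradiction 0<n λ () }

  -- Moving from w to w + tζ along a descent direction gives A + τ (b + t s) with τ = tᵏ⁺¹ and b =
  -- ζᵏ⁺¹ c, to which `perturb-smaller` applies.
  smaller-value : ∀ {n} (as : Vec ℂ (suc n)) w → ¬ (evalᶜ as w ≈ᶜ 0ᶜ) →
    ¬ ¬ (∃ λ z → N (evalᶜ as z) < N (evalᶜ as w))
  smaller-value as w A≉0 ¬smaller =
    let A = evalᶜ as w
        (k , m , bs , c≉0 , expand) = first-nonzero-term as w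
        c = evalᶜ bs w
    in descent-direction (suc k) (ℕ.s≤s ℕ.z≤n) A c A≉0 c≉0 λ (ζ , lt) →
    let b = ζ ^ᶜ suc k *ᶜ c
        e = ζ ^ᶜ suc k *ᶜ ζ
        -- The radius N ζ is independent of t: as t ≤ 1, the point w + tζ stays within it. Hence S
        -- can be fixed before t.
        (M , 0≤M , bound) = slope-bounded bs w (N ζ) (0≤N ζ)
        S = N e * M
        (t , 0<t , t≤1 , smaller) = perturb-smaller A b S lt (0≤* (0≤N e) 0≤M)
        (τ , 0<τ , τ≤t , tᵏ≈τ) = ofReal-^ 0<t t≤1 k
        z = w +ᶜ ofReal t *ᶜ ζ
        D≈ : z -ᶜ w ≈ᶜ ofReal t *ᶜ ζ
        D≈ = ℂS.solve 2 (λ w d → (w ℂS.:+ d) ℂS.:- w ℂS.:= d) ℂR.refl w (ofReal t *ᶜ ζ)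
        tt≤1 = ≤-trans (*-mono-≤ (<⇒≤ 0<t) (<⇒≤ 0<1) t≤1 t≤1) (≤-reflexive (*-identityʳ 1#))
        ND≤ : N (z -ᶜ w) ≤ N ζ
        ND≤ = ≤-cong (sym (trans (N-cong D≈) (trans (N-* (ofReal t) ζ) (*-congʳ (N-ofReal t)))))
                (*-identityˡ (N ζ)) (*-monoˡ-≤ (0≤N ζ) tt≤1)
        q = slope bs w z
        s = e *ᶜ q
        Ns≤S = ≤-trans (≤-reflexive (N-* e q)) (*-mono-≤ (0≤N q) (0≤N e) ≤-refl (bound z ND≤))
        value : evalᶜ as z ≈ᶜ A +ᶜ ofReal τ *ᶜ (b +ᶜ ofReal t *ᶜ s)
        value = ℂR.trans (expand z) (ℂR.+-congˡ (ℂR.trans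
          (ℂR.*-cong
            (ℂR.trans (^ᶜ-congˡ (suc k) D≈) (ℂR.trans (^ᶜ-distrib-* (ofReal t) ζ (suc k)) (ℂR.*-congʳ tᵏ≈τ)))
            (ℂR.trans (eval-slope bs w z) (ℂR.+-congˡ (ℂR.*-congʳ D≈))))
          (ℂS.solve 6 (λ τ p c t ζ q → (τ ℂS.:* p) ℂS.:* (c ℂS.:+ (t ℂS.:* ζ) ℂS.:* q)
            ℂS.:= τ ℂS.:* (p ℂS.:* c ℂS.:+ t ℂS.:* (p ℂS.:* ζ ℂS.:* q)))
            ℂR.refl (ofReal τ) (ζ ^ᶜ suc k) c (ofReal t) ζ q)))
    in ¬smaller (z , <-cong (sym (N-cong value)) refl (smaller τ s 0<τ τ≤t Ns≤S))

  box-bound : ∀ {x K} → 0# ≤ K → x * x < K → - (2# + K) ≤ x × x < 1# + K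
  box-bound {x} {K} 0≤K xx<K =
    let near = ²⇒near {c = 0#} (0<+₁ 0<1 0≤K) (<-trans
                 (<-cong (solve 1 (λ x → x :* x := (x :- con (+ 0)) :* (x :- con (+ 0))) refl x) refl xx<K)
                 (0<⇒< (0<+₁ 0<1 (0≤+ 0≤K (0≤² K)))
                   (solve 1 (λ k → con (+ 1) :+ (k :+ k :* k)
                     := (con (+ 1) :+ k) :* (con (+ 1) :+ k) :- k) refl K)))
    in <⇒≤ (<-trans (0<⇒< 0<1 (solve 1 (λ k → con (+ 1) := (con (+ 0) :- (con (+ 1) :+ k)) :- (:- (con (+ 2) :+ k))) refl K))
              (proj₁ near))
     , <-cong refl (+-identityˡ _) (proj₂ near)

  -- Two nested real inductions replace the compactness of a square.
  uniform-on-square : ∀ (F : ℂ → ℝ) μ →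
    (∀ w → ∃ λ ρ → 0# < ρ × ∃ λ η → 0# < η × (∀ z → N (z -ᶜ w) ≤ ρ → μ + η ≤ F z)) →
    ∀ {A B} → A ≤ B →
    ¬ ¬ (∃ λ ε → 0# < ε × (∀ x y → A ≤ x → x < B → A ≤ y → y < B → μ + ε ≤ F (x +i y)))
  uniform-on-square F μ local {A} {B} A≤B =
    -- The strict bound x < b makes the property vacuous at b = A.
    real-induction (λ b → ∃ λ ε → 0# < ε × (∀ x y → A ≤ x → x < b → A ≤ y → y < B → μ + ε ≤ F (x +i y)))
      A≤B (1# , 0<1 , λ x y A≤x x<A → contradiction x<A (≤⇒≯ A≤x))
      λ c A≤c c≤B k → strip c λ (ε , 0<ε , δ , 0<δ , on-strip) →
        k (δ , 0<δ , λ s t A≤s A≤t t≤B near-s s≤c near-t (ε₁ , 0<ε₁ , below-s) →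
          let (ε₂ , ε₂≤ε , ε₂≤ε₁ , max) = min ε ε₁ in
          ε₂ , max 0<ε 0<ε₁ , λ x y A≤x x<t A≤y y<B → case ≤⊎> s x of λ
            { (inj₁ s≤x) → ≤-trans (+-mono-≤ ≤-refl ε₂≤ε)
                (on-strip x y (<-≤-trans (proj₁ near-s) s≤x , <-trans x<t (proj₂ near-t)) A≤y y<B)
            ; (inj₂ x<s) → ≤-trans (+-mono-≤ ≤-refl ε₂≤ε₁) (below-s x y A≤x x<s A≤y y<B) })
    where
    Strip : ℝ → ℝ → Set
    Strip c b = ∃ λ ε → 0# < ε × ∃ λ δ → 0# < δ ×
      (∀ x y → Near δ c x → A ≤ y → y < b → μ + ε ≤ F (x +i y))
    strip : ∀ c → ¬ ¬ Strip c B
    strip c = real-induction (Strip c) A≤B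
      (1# , 0<1 , 1# , 0<1 , λ x y _ A≤y y<A → contradiction y<A (≤⇒≯ A≤y))
      λ d A≤d d≤B k →
        let (ρ , 0<ρ , η , 0<η , near-w) = local (c +i d)
            -- δ ≤ 1 and 2δ ≤ ρ give δ² + δ² ≤ ρ for the squared distance.
            (δ , 0<δ , δ≤1 , δ2≤ρ) = scale-down 0<ρ (<⇒≤ 0<2)
            δδ≤δ = ≤-trans (*-mono-≤ (<⇒≤ 0<δ) (<⇒≤ 0<δ) ≤-refl δ≤1) (≤-reflexive (*-identityʳ δ))
            small : ∀ {x y} → Near δ c x → Near δ d y → N ((x +i y) -ᶜ (c +i d)) ≤ ρ
            small near-x near-y = ≤-trans (+-mono-≤ (≤-trans (<⇒≤ (near⇒² near-x)) δδ≤δ)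
              (≤-trans (<⇒≤ (near⇒² near-y)) δδ≤δ))
              (≤-trans (≤-reflexive (solve 1 (λ d → d :+ d := d :* con (+ 2)) refl δ)) δ2≤ρ)
        in k (δ , 0<δ , λ s t A≤s A≤t t≤B near-s s≤d near-t (ε , 0<ε , δ₁ , 0<δ₁ , below-s) →
          let (ε₂ , ε₂≤ε , ε₂≤η , ε-max) = min ε η
              (δ₂ , δ₂≤δ , δ₂≤δ₁ , δ-max) = min δ δ₁
          in ε₂ , ε-max 0<ε 0<η , δ₂ , δ-max 0<δ 0<δ₁ , λ x y near-x A≤y y<t → case ≤⊎> s y of λ
            { (inj₁ s≤y) → ≤-trans (+-mono-≤ ≤-refl ε₂≤η) (near-w (x +i y)
                (small (near-weaken δ₂≤δ near-x) (<-≤-trans (proj₁ near-s) s≤y , <-trans y<t (proj₂ near-t))))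
            ; (inj₂ y<s) → ≤-trans (+-mono-≤ ≤-refl ε₂≤ε)
                (below-s x y (near-weaken δ₂≤δ₁ near-x) A≤y y<s) })

  -- Let μ be the infimum of N P. Without a root, `smaller-value` gives μ < N P at each point. Lower
  -- semicontinuity makes this margin uniform on a square, and coercivity provides a margin outside.
  -- So some μ + ε₁ is a lower bound, which is absurd.
  fundamental-theorem-of-algebra : ∀ {n} (as : Vec ℂ (suc n)) → ¬ ¬ (∃ λ z → evalᶜ as z ≈ᶜ 0ᶜ)
  fundamental-theorem-of-algebra as no-root =
    uniform-on-square F μ (λ w → eval-lower-semicontinuous as w μ (μ<F w)) A≤B
    λ (ε , 0<ε , in-square) →
      let (ε₁ , ε₁≤ε , ε₁≤1 , max) = min ε 1#
          lower : LowerBound (μ + ε₁)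
          lower z = case ≤⊎> K (N z) of λ
            { (inj₁ K≤Nz) → ≤-trans (+-mono-≤ ≤-refl ε₁≤1) (far z K≤Nz)
            ; (inj₂ Nz<K) →
                let (A≤x , x<B) = box-bound 0≤K (≤-<-trans (0≤⇒≤ (0≤² (im z))
                      (solve 2 (λ x y → y := (x :+ y) :- x) refl _ _)) Nz<K)
                    (A≤y , y<B) = box-bound 0≤K (≤-<-trans (0≤⇒≤ (0≤² (re z))
                      (solve 2 (λ x y → x := (x :+ y) :- y) refl _ _)) Nz<K)
                in ≤-trans (+-mono-≤ ≤-refl ε₁≤ε) (in-square (re z) (im z) A≤x x<B A≤y y<B) }
      in ≤⇒≯ (ub lower) (0<⇒< (max 0<ε 0<1) (solve 2 (λ m e → e := (m :+ e) :- m) refl μ ε₁))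
    where
    F : ℂ → ℝ
    F z = N (evalᶜ as z)
    LowerBound : ℝ → Set
    LowerBound b = ∀ z → b ≤ F z
    inf = supremum LowerBound (0# , λ z → 0≤N (evalᶜ as z)) (F 0ᶜ , λ b≤ → b≤ 0ᶜ)
    μ = proj₁ inf
    ub : UpperBound LowerBound μ
    ub = proj₁ (proj₂ inf)
    μ≤F : LowerBound μ
    μ≤F z = proj₂ (proj₂ inf) λ b≤ → b≤ z
    0≤μ : 0# ≤ μ
    0≤μ = ub λ z → 0≤N (evalᶜ as z)
    μ<F : ∀ w → μ < F w
    μ<F w = ≰⇒> λ Fw≤μ → smaller-value as w (λ Pw≈0 → no-root (w , Pw≈0))
      λ (z , lt) → ≤⇒≯ (μ≤F z) (<-≤-trans lt Fw≤μ)
    -- The bound μ + 1 gives margin 1 where N z ≥ K, hence the minimum of ε and 1 above.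
    coercive = eval-coercive as (μ + 1#) (0≤+ 0≤μ (<⇒≤ 0<1))
    K = proj₁ coercive
    0≤K = proj₁ (proj₂ coercive)
    far = proj₂ (proj₂ coercive)
    A≤B : - (2# + K) ≤ 1# + K
    A≤B = 0≤⇒≤ (0≤+ (0≤+ (<⇒≤ 0<1) 0≤K) (0≤+ (<⇒≤ 0<2) 0≤K))
      (solve 1 (λ k → (con (+ 1) :+ k) :+ (con (+ 2) :+ k) := (con (+ 1) :+ k) :- (:- (con (+ 2) :+ k))) refl K)

  -- Up to sign the constant term is the product of the roots. One root w is split off at a time,
  -- and the roots of the quotient are again roots of the original polynomial.
  constant-term-bounded : ∀ {n} (as : Vec ℂ n) →
    (∀ z → evalᶜ as z ≈ᶜ 0ᶜ → N z ≤ 1#) → N (evalᶜ as 0ᶜ) ≤ 1#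
  constant-term-bounded [] _ = ≤-reflexive N1≈1
  constant-term-bounded as@(_ ∷ _) roots≤1 = ≮⇒≥ λ 1<N →
    fundamental-theorem-of-algebra as λ (w , Pw≈0) →
    let Q = quotient as w
        factor : ∀ z → evalᶜ as z ≈ᶜ (z -ᶜ w) *ᶜ evalᶜ Q z
        factor z = ℂR.trans (eval-quotient as w z) (ℂR.trans (ℂR.+-congʳ Pw≈0) (ℂR.+-identityˡ _))
        NQ0≤1 = constant-term-bounded Q λ z Qz≈0 →
          roots≤1 z (ℂR.trans (factor z) (ℂR.trans (ℂR.*-congˡ Qz≈0) (ℂR.zeroʳ _)))
        N≈ = trans (N-cong (factor 0ᶜ)) (trans (N-* (0ᶜ -ᶜ w) (evalᶜ Q 0ᶜ)) (*-congʳ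
               (solve 2 (λ x y → (con (+ 0) :- x) :* (con (+ 0) :- x) :+ (con (+ 0) :- y) :* (con (+ 0) :- y)
                 := x :* x :+ y :* y) refl (re w) (im w))))
    in ≤⇒≯ (≤-trans (≤-reflexive N≈) (≤-trans
         (*-mono-≤ (0≤N (evalᶜ Q 0ᶜ)) (<⇒≤ 0<1) (roots≤1 w Pw≈0) NQ0≤1)
         (≤-reflexive (*-identityʳ 1#)))) 1<N

-- Polynomials as coefficient sequences: products, division, evaluation

module CoefficientSequences {c ℓ} (R : CommutativeRing c ℓ) where
  open CommutativeRing R
  open IntegerCoefficients R using (solve; _:+_; _:*_; _:-_; :-_; _:=_; con)
  open import Relation.Binary.Reasoning.Setoid setoid

  -- Infinite sequences with a bound on their support also represent zero and nonmonic polynomials,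
  -- and products need no length bookkeeping.
  VanishesFrom : ℕ → (ℕ → Carrier) → Set ℓ
  VanishesFrom n f = ∀ {i} → n ℕ.≤ i → f i ≈ 0#

  cons : Carrier → (ℕ → Carrier) → ℕ → Carrier
  cons a f zero    = a
  cons a f (suc i) = f i

  conv : (ℕ → Carrier) → (ℕ → Carrier) → ℕ → Carrier
  conv f g zero    = f 0 * g 0
  conv f g (suc i) = f 0 * g (suc i) + conv (f ∘ suc) g i

  -- `conv` peels off the first coefficient of f; this is the mirror recursion for g.
  conv-tailʳ : ∀ f g i → conv f g (suc i) ≈ g 0 * f (suc i) + conv f (g ∘ suc) i
  conv-tailʳ f g zero = solve 4 (λ a b x y → a :* y :+ b :* x := x :* b :+ a :* y) refl
    (f 0) (f 1) (g 0) (g 1)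
  conv-tailʳ f g (suc i) = trans (+-congˡ (conv-tailʳ (f ∘ suc) g i))
    (solve 5 (λ a b x y z → a :* y :+ (x :* b :+ z) := x :* b :+ (a :* y :+ z)) refl
      (f 0) (f (suc (suc i))) (g 0) (g (suc (suc i))) (conv (f ∘ suc) (g ∘ suc) i))

  conv-zeroˡ : ∀ f g → VanishesFrom 0 f → ∀ i → conv f g i ≈ 0#
  conv-zeroˡ f g f≈0 zero    = trans (*-congʳ (f≈0 ℕ.z≤n)) (zeroˡ _)
  conv-zeroˡ f g f≈0 (suc i) = trans (+-cong (trans (*-congʳ (f≈0 ℕ.z≤n)) (zeroˡ _))
    (conv-zeroˡ (f ∘ suc) g (λ _ → f≈0 ℕ.z≤n) i)) (+-identityˡ 0#)

  conv-constʳ : ∀ f a i → conv f (cons a (λ _ → 0#)) i ≈ a * f i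
  conv-constʳ f a zero    = *-comm _ _
  conv-constʳ f a (suc i) = trans (+-cong (zeroʳ _) (conv-constʳ (f ∘ suc) a i)) (+-identityˡ _)

  conv-scale : ∀ f g a b i → conv (λ j → a * f j) (λ j → b * g j) i ≈ (a * b) * conv f g i
  conv-scale f g a b zero = solve 4 (λ a f b g → (a :* f) :* (b :* g) := (a :* b) :* (f :* g)) refl a (f 0) b (g 0)
  conv-scale f g a b (suc i) = trans (+-congˡ (conv-scale (f ∘ suc) g a b i))
    (solve 5 (λ a f b g x → (a :* f) :* (b :* g) :+ (a :* b) :* x := (a :* b) :* (f :* g :+ x)) refl
      a (f 0) b (g (suc i)) (conv (f ∘ suc) g i))

  conv-cong : ∀ {f f′ g g′} → (∀ i → f i ≈ f′ i) → (∀ i → g i ≈ g′ i) → ∀ i → conv f g i ≈ conv f′ g′ i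
  conv-cong f≈ g≈ zero    = *-cong (f≈ 0) (g≈ 0)
  conv-cong f≈ g≈ (suc i) = +-cong (*-cong (f≈ 0) (g≈ (suc i))) (conv-cong (f≈ ∘ suc) g≈ i)

  conv-top : ∀ n k f g → VanishesFrom (suc n) f → VanishesFrom (suc k) g →
    conv f g (n ℕ.+ k) ≈ f n * g k
  conv-top zero zero    f g f≈0 g≈0 = refl
  conv-top zero (suc k) f g f≈0 g≈0 =
    trans (+-congˡ (conv-zeroˡ (f ∘ suc) g (λ _ → f≈0 (ℕ.s≤s ℕ.z≤n)) k)) (+-identityʳ _)
  conv-top (suc n) k f g f≈0 g≈0 = trans
    (+-cong (trans (*-congˡ (g≈0 (ℕ.s≤s (ℕ.m≤n+m k n)))) (zeroʳ _))
      (conv-top n k (f ∘ suc) g (f≈0 ∘ ℕ.s≤s) g≈0))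
    (+-identityˡ _)

  -- Division with remainder, the remainder being whatever f and p g differ by below index n. The
  -- quotient of f without its constant term, shifted down, supplies all coefficients but the
  -- lowest.
  monic-quotient : ∀ n p → p n ≈ 1# → VanishesFrom (suc n) p →
    ∀ k f → f (k ℕ.+ n) ≈ 1# → VanishesFrom (suc (k ℕ.+ n)) f →
    ∃ λ g → VanishesFrom (suc k) g × (∀ {i} → n ℕ.≤ i → f i ≈ conv p g i)
  monic-quotient n p p≈1 p≈0 zero f f≈1 f≈0 =
    cons 1# (λ _ → 0#) , (λ { (ℕ.s≤s _) → refl }) , λ {i} n≤i →
    trans (f≈p n≤i) (sym (trans (conv-constʳ p 1# i) (*-identityˡ _)))
    where
    f≈p : ∀ {i} → n ℕ.≤ i → f i ≈ p i
    f≈p n≤i with ℕ.m≤n⇒m<n∨m≡n n≤i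
    ... | inj₁ n<i    = trans (f≈0 n<i) (sym (p≈0 n<i))
    ... | inj₂ ≡.refl = trans f≈1 (sym p≈1)
  monic-quotient n p p≈1 p≈0 (suc k) f f≈1 f≈0 =
    let (g , g≈0 , f≈) = monic-quotient n p p≈1 p≈0 k (f ∘ suc) f≈1 (f≈0 ∘ ℕ.s≤s)
        -- What index n still lacks after X g is accounted for; since p n = 1, the new coefficient
        -- contributes exactly a there.
        a = f n - conv p (cons 0# g) n
    in cons a g , (λ { (ℕ.s≤s k<i) → g≈0 k<i }) , λ n≤i → case ℕ.m≤n⇒m<n∨m≡n n≤i of λ
      { (inj₁ (ℕ.s≤s {n = j} n≤j)) → trans (f≈ n≤j) (sym (trans (conv-tailʳ p (cons a g) j)
          (trans (+-congʳ (trans (*-congˡ (p≈0 (ℕ.s≤s n≤j))) (zeroʳ a))) (+-identityˡ _))))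
      ; (inj₂ ≡.refl) → sym (begin
          conv p (cons a g) n                          ≈⟨ conv-cons a g n ⟩
          a * p n + conv p (cons 0# g) n               ≈⟨ +-congʳ (trans (*-congˡ p≈1) (*-identityʳ a)) ⟩
          a + conv p (cons 0# g) n                     ≈⟨ solve 2 (λ f c → (f :- c) :+ c := f) refl (f n) _ ⟩
          f n                                          ∎) }
    where
    conv-cons : ∀ a g i → conv p (cons a g) i ≈ a * p i + conv p (cons 0# g) i
    conv-cons a g zero    = solve 2 (λ a p → p :* a := a :* p :+ p :* con (+ 0)) refl a (p 0)
    conv-cons a g (suc i) = trans (conv-tailʳ p (cons a g) i) (+-congˡ (sym
      (trans (conv-tailʳ p (cons 0# g) i) (trans (+-congʳ (zeroˡ _)) (+-identityˡ _)))))

  -- The first argument counts coefficients, so degree n is evaluated with `suc n`.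
  eval : ℕ → (ℕ → Carrier) → Carrier → Carrier
  eval zero    f x = 0#
  eval (suc k) f x = f 0 + x * eval k (f ∘ suc) x

  eval-cong : ∀ k {f g} x → (∀ i → f i ≈ g i) → eval k f x ≈ eval k g x
  eval-cong zero    x f≈g = refl
  eval-cong (suc k) x f≈g = +-cong (f≈g 0) (*-congˡ (eval-cong k x (f≈g ∘ suc)))

  eval-linear : ∀ k f g a b x → eval k (λ i → a * f i + b * g i) x ≈ a * eval k f x + b * eval k g x
  eval-linear zero    f g a b x = solve 2 (λ a b → con (+ 0) := a :* con (+ 0) :+ b :* con (+ 0)) refl a b
  eval-linear (suc k) f g a b x = trans (+-congˡ (*-congˡ (eval-linear k (f ∘ suc) (g ∘ suc) a b x)))
    (solve 7 (λ a b f g x u v → a :* f :+ b :* g :+ x :* (a :* u :+ b :* v)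
      := a :* (f :+ x :* u) :+ b :* (g :+ x :* v)) refl
      a b (f 0) (g 0) x (eval k (f ∘ suc) x) (eval k (g ∘ suc) x))

  eval-zero : ∀ k f x → VanishesFrom 0 f → eval k f x ≈ 0#
  eval-zero zero    f x f≈0 = refl
  eval-zero (suc k) f x f≈0 = trans (+-cong (f≈0 ℕ.z≤n) (trans
    (*-congˡ (eval-zero k (f ∘ suc) x λ _ → f≈0 ℕ.z≤n)) (zeroʳ x))) (+-identityˡ 0#)

  eval-extend : ∀ {k l} f x → k ℕ.≤ l → VanishesFrom k f → eval l f x ≈ eval k f x
  eval-extend {l = l} f x ℕ.z≤n f≈0 = eval-zero l f x f≈0
  eval-extend f x (ℕ.s≤s k≤l) f≈0 = +-congˡ (*-congˡ (eval-extend (f ∘ suc) x k≤l (f≈0 ∘ ℕ.s≤s)))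

  eval-conv : ∀ n k f g x → VanishesFrom n f → VanishesFrom k g →
    eval (n ℕ.+ k) (conv f g) x ≈ eval n f x * eval k g x
  eval-conv zero k f g x f≈0 g≈0 =
    trans (eval-zero k (conv f g) x (λ {i} _ → conv-zeroˡ f g f≈0 i)) (sym (zeroˡ _))
  eval-conv (suc n) k f g x f≈0 g≈0 = begin
    f 0 * g 0 + x * eval m (λ i → f 0 * g (suc i) + conv (f ∘ suc) g i) x
      ≈⟨ +-congˡ (*-congˡ (trans
           (eval-cong m x (λ i → +-congˡ (sym (*-identityˡ _))))
           (eval-linear m (g ∘ suc) (conv (f ∘ suc) g) (f 0) 1# x))) ⟩
    f 0 * g 0 + x * (f 0 * eval m (g ∘ suc) x + 1# * eval m (conv (f ∘ suc) g) x)
      ≈⟨ +-congˡ (*-congˡ (+-congˡ (*-congˡ (eval-conv n k (f ∘ suc) g x (f≈0 ∘ ℕ.s≤s) g≈0)))) ⟩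
    f 0 * g 0 + x * (f 0 * eval m (g ∘ suc) x + 1# * (eval n (f ∘ suc) x * eval k g x))
      ≈⟨ solve 6 (λ f g x u v w → f :* g :+ x :* (f :* u :+ con (+ 1) :* (v :* w))
           := f :* (g :+ x :* u) :+ x :* v :* w) refl
           (f 0) (g 0) x (eval m (g ∘ suc) x) (eval n (f ∘ suc) x) (eval k g x) ⟩
    f 0 * eval (suc m) g x + x * eval n (f ∘ suc) x * eval k g x
      ≈⟨ +-congʳ (*-congˡ (eval-extend g x (ℕ.m≤n+m k (suc n)) g≈0)) ⟩
    f 0 * eval k g x + x * eval n (f ∘ suc) x * eval k g x
      ≈⟨ solve 4 (λ f u x v → f :* u :+ x :* v :* u := (f :+ x :* v) :* u) refl
           (f 0) (eval k g x) x (eval n (f ∘ suc) x) ⟩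
    (f 0 + x * eval n (f ∘ suc) x) * eval k g x ∎
    where m = n ℕ.+ k

  pow : Carrier → ℕ → Carrier
  pow x zero    = 1#
  pow x (suc k) = x * pow x k

  eval-top : ∀ k f x → eval (suc k) f x ≈ eval k f x + f k * pow x k
  eval-top zero    f x = solve 2 (λ f x → f :+ x :* con (+ 0) := con (+ 0) :+ f :* con (+ 1)) refl (f 0) x
  eval-top (suc k) f x = trans (+-congˡ (*-congˡ (eval-top k (f ∘ suc) x)))
    (solve 5 (λ f x u a p → f :+ x :* (u :+ a :* p) := (f :+ x :* u) :+ a :* (x :* p)) refl
      (f 0) x (eval k (f ∘ suc) x) (f (suc k)) (pow x k))

-- Integers among the rationals, and Gauss's lemma

module ℤSeq = CoefficientSequences ℤ.+-*-commutativeRing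
module ℚSeq = CoefficientSequences ℚ.+-*-commutativeRing

toℚ : ℤ → ℚ
toℚ z = z ℚ./ 1

toℚᵘ-toℚ : ∀ z → toℚᵘ (toℚ z) ℚᵘ.≃ ℚᵘ.mkℚᵘ z 0
toℚᵘ-toℚ z = ℚ.toℚᵘ-fromℚᵘ (ℚᵘ.mkℚᵘ z 0)

toℚ-+ : ∀ a b → toℚ (a ℤ.+ b) ≡ toℚ a ℚ.+ toℚ b
toℚ-+ a b = ℚ.toℚᵘ-injective (ℚᵘ.≃-trans (toℚᵘ-toℚ (a ℤ.+ b)) (ℚᵘ.≃-trans
  (ℚᵘ.*≡* (≡.cong (ℤ._* + 1) (≡.cong₂ ℤ._+_ (≡.sym (ℤ.*-identityʳ a)) (≡.sym (ℤ.*-identityʳ b)))))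
  (ℚᵘ.≃-sym (ℚᵘ.≃-trans (ℚ.toℚᵘ-homo-+ (toℚ a) (toℚ b)) (ℚᵘ.+-cong (toℚᵘ-toℚ a) (toℚᵘ-toℚ b))))))

toℚ-* : ∀ a b → toℚ (a ℤ.* b) ≡ toℚ a ℚ.* toℚ b
toℚ-* a b = ℚ.toℚᵘ-injective (ℚᵘ.≃-trans (toℚᵘ-toℚ (a ℤ.* b))
  (ℚᵘ.≃-sym (ℚᵘ.≃-trans (ℚ.toℚᵘ-homo-* (toℚ a) (toℚ b)) (ℚᵘ.*-cong (toℚᵘ-toℚ a) (toℚᵘ-toℚ b)))))

toℚ-injective : ∀ {a b} → toℚ a ≡ toℚ b → a ≡ b
toℚ-injective {a} {b} eq with ℚᵘ.≃-trans (ℚᵘ.≃-sym (toℚᵘ-toℚ a))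
  (ℚᵘ.≃-trans (ℚᵘ.≃-reflexive (≡.cong toℚᵘ eq)) (toℚᵘ-toℚ b))
... | ℚᵘ.*≡* a*1≡b*1 = ≡.trans (≡.sym (ℤ.*-identityʳ a)) (≡.trans a*1≡b*1 (ℤ.*-identityʳ b))

toℚ-↥ : ∀ q → toℚ (↥ q) ≡ toℚ (↧ q) ℚ.* q
toℚ-↥ q = ℚ.toℚᵘ-injective (ℚᵘ.≃-trans (toℚᵘ-toℚ (↥ q)) (ℚᵘ.≃-trans (eq q)
  (ℚᵘ.≃-sym (ℚᵘ.≃-trans (ℚ.toℚᵘ-homo-* (toℚ (↧ q)) q) (ℚᵘ.*-congʳ {toℚᵘ q} (toℚᵘ-toℚ (↧ q)))))))
  where
  eq : ∀ q → ℚᵘ.mkℚᵘ (↥ q) 0 ℚᵘ.≃ ℚᵘ.mkℚᵘ (↧ q) 0 ℚᵘ.* toℚᵘ q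
  eq (ℚ.mkℚ n d-1 _) = ℚᵘ.*≡* (≡.trans
    (≡.cong (λ d → n ℤ.* (+ suc d)) (ℕ.+-identityʳ d-1))
    (≡.trans (ℤ.*-comm n (+ suc d-1)) (≡.sym (ℤ.*-identityʳ (+ suc d-1 ℤ.* n)))))

toℚ-conv : ∀ f g i → toℚ (ℤSeq.conv f g i) ≡ ℚSeq.conv (toℚ ∘ f) (toℚ ∘ g) i
toℚ-conv f g zero    = toℚ-* (f 0) (g 0)
toℚ-conv f g (suc i) = ≡.trans (toℚ-+ (f 0 ℤ.* g (suc i)) _)
  (≡.cong₂ ℚ._+_ (toℚ-* (f 0) (g (suc i))) (toℚ-conv (f ∘ suc) g i))

clear-denominators : ∀ n f → ℚSeq.VanishesFrom n f →
  ∃₂ λ (d : ℕ) (F : ℕ → ℤ) → ℕ.NonZero d × (∀ i → toℚ (F i) ≡ toℚ (+ d) ℚ.* f i)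
clear-denominators zero f f≡0 = 1 , (λ _ → + 0) , _ , λ i →
  ≡.sym (≡.trans (≡.cong (toℚ (+ 1) ℚ.*_) (f≡0 ℕ.z≤n)) (ℚ.*-zeroʳ (toℚ (+ 1))))
clear-denominators (suc n) f f≡0 =
  let (d , F , d≢0 , F≡) = clear-denominators n (f ∘ suc) (f≡0 ∘ ℕ.s≤s)
      q = f 0
      D = ↧ₙ q ℕ.* d
      D≡ : toℚ (+ D) ≡ toℚ (↧ q) ℚ.* toℚ (+ d)
      D≡ = ≡.trans (≡.cong toℚ (ℤ.pos-* (↧ₙ q) d)) (toℚ-* (↧ q) (+ d))
  in D , ℤSeq.cons (+ d ℤ.* ↥ q) (λ i → ↧ q ℤ.* F i) , ℕ.m*n≢0 (↧ₙ q) d {{_}} {{d≢0}} , λ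
    { zero → ≡.trans (toℚ-* (+ d) (↥ q)) (≡.trans (≡.cong (toℚ (+ d) ℚ.*_) (toℚ-↥ q))
        (≡.trans (≡.sym (ℚ.*-assoc (toℚ (+ d)) (toℚ (↧ q)) q))
          (≡.cong (ℚ._* q) (≡.trans (ℚ.*-comm (toℚ (+ d)) (toℚ (↧ q))) (≡.sym D≡)))))
    ; (suc i) → ≡.trans (toℚ-* (↧ q) (F i)) (≡.trans (≡.cong (toℚ (↧ q) ℚ.*_) (F≡ i))
        (≡.trans (≡.sym (ℚ.*-assoc (toℚ (↧ q)) (toℚ (+ d)) (f (suc i))))
          (≡.cong (ℚ._* f (suc i)) (≡.sym D≡)))) }

prime-divides-* : ∀ {l} → Prime l → ∀ a b → + l ∣ℤ a ℤ.* b → + l ∣ℤ a ⊎ + l ∣ℤ b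
prime-divides-* pl a b l∣ab = Sum.map ℤ∣.∣ᵤ⇒∣ ℤ∣.∣ᵤ⇒∣
  (euclidsLemma ℤ.∣ a ∣ ℤ.∣ b ∣ pl (≡.subst (_ ℕ∣.∣_) (ℤ.abs-* a b) (ℤ∣.∣⇒∣ᵤ l∣ab)))

prime-divides-conv : ∀ {l} → Prime l → ∀ f g → (∀ k → + l ∣ℤ ℤSeq.conv f g k) →
  ∀ i j → + l ∣ℤ f i ⊎ + l ∣ℤ g j
prime-divides-conv pl f g l∣fg i j with prime-divides-* pl (f 0) (g 0) (l∣fg 0)
prime-divides-conv pl f g l∣fg zero    j | inj₁ l∣f₀ = inj₁ l∣f₀
prime-divides-conv pl f g l∣fg (suc i) j | inj₁ l∣f₀ =
  prime-divides-conv pl (f ∘ suc) g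
    (λ k → ℤ∣.∣m+n∣m⇒∣n (l∣fg (suc k)) (ℤ∣.∣m⇒∣m*n (g (suc k)) l∣f₀)) i j
prime-divides-conv pl f g l∣fg i zero    | inj₂ l∣g₀ = inj₂ l∣g₀
prime-divides-conv pl f g l∣fg i (suc j) | inj₂ l∣g₀ =
  prime-divides-conv pl f (g ∘ suc)
    (λ k → ℤ∣.∣m+n∣m⇒∣n (≡.subst (_ ∣ℤ_) (ℤSeq.conv-tailʳ f g k) (l∣fg (suc k)))
             (ℤ∣.∣m⇒∣m*n (f (suc k)) l∣g₀)) i j

-- Deciding which alternative holds would mean searching an infinite sequence, so it is asserted
-- only under ¬¬.
all⊎all : ∀ {A B : ℕ → Set} → (∀ j → Dec (B j)) → (∀ i j → A i ⊎ B j) →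
  ¬ ¬ ((∀ i → A i) ⊎ (∀ j → B j))
all⊎all {B = B} B? A⊎B k = k (inj₂ λ j → case B? j of λ
  { (yes b) → b
  ; (no ¬b) → ⊥-elim (k (inj₁ λ i → [ (λ a → a) , (λ b → contradiction b ¬b) ]′ (A⊎B i j))) })

ℚ-cancelˡ : ∀ {r} → ¬ (r ≡ ℚ.0ℚ) → ∀ {x y} → r ℚ.* x ≡ r ℚ.* y → x ≡ y
ℚ-cancelˡ {r} r≢0 {x} {y} rx≡ry = ≡.trans (≡.sym (undo x))
  (≡.trans (≡.cong (ℚ.1/ r ℚ.*_) rx≡ry) (undo y))
  where
  instance _ = ℚ.≢-nonZero r≢0
  undo : ∀ z → ℚ.1/ r ℚ.* (r ℚ.* z) ≡ z
  undo z = ≡.trans (≡.sym (ℚ.*-assoc (ℚ.1/ r) r z))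
    (≡.trans (≡.cong (ℚ._* z) (ℚ.*-inverseˡ r)) (ℚ.*-identityˡ z))

Integral : (ℕ → ℚ) → Set
Integral p = ∃ λ (a : ℕ → ℤ) → ∀ i → toℚ (a i) ≡ p i

-- Gauss's lemma: in e f = P K the primes of e are cancelled one at a time, each
-- against the factor it divides, until the leading coefficients are inverse to
-- each other.
module _ (p : ℕ → ℚ) (f : ℕ → ℤ) (n k : ℕ) (f≡1 : f (n ℕ.+ k) ≡ + 1) where

  -- P is p scaled by the leading coefficient of P. In this form the property survives dividing P by
  -- a prime.
  Proportional : (ℕ → ℤ) → Set
  Proportional P = ∀ i → toℚ (P i) ≡ toℚ (P n) ℚ.* p i

  integral-factor : ∀ {ls} → All Prime ls → ∀ P K →
    ℤSeq.VanishesFrom (suc n) P → ℤSeq.VanishesFrom (suc k) K → Proportional P →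
    (∀ i → + product ls ℤ.* f i ≡ ℤSeq.conv P K i) → ¬ ¬ Integral p
  -- With no primes left, comparing leading coefficients gives K k · P n = 1, so multiplying P by K
  -- k recovers p with integer coefficients.
  integral-factor [] P K P≡0 K≡0 prop f≡PK κ = κ ((λ i → K k ℤ.* P i) , λ i →
    ≡.trans (toℚ-* (K k) (P i)) (≡.trans (≡.cong (toℚ (K k) ℚ.*_) (prop i))
      (≡.trans (≡.sym (ℚ.*-assoc (toℚ (K k)) (toℚ (P n)) (p i)))
        (≡.trans (≡.cong (ℚ._* p i) (≡.trans (≡.sym (toℚ-* (K k) (P n))) (≡.cong toℚ KₖPₙ≡1)))
          (ℚ.*-identityˡ (p i))))))
    where
    KₖPₙ≡1 : K k ℤ.* P n ≡ + 1
    KₖPₙ≡1 = ≡.trans (ℤ.*-comm (K k) (P n)) (≡.trans (≡.sym (ℤSeq.conv-top n k P K P≡0 K≡0))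
      (≡.trans (≡.sym (f≡PK (n ℕ.+ k))) (≡.cong (+ 1 ℤ.*_) f≡1)))
  integral-factor {l ∷ ls} (pl ∷ pls) P K P≡0 K≡0 prop f≡PK κ =
    all⊎all (λ j → + l ℤ∣.∣? K j) (prime-divides-conv pl P K l∣PK) λ
      { (inj₁ l∣P) → let (P′ , P≡) = divide P l∣P in
          integral-factor pls P′ K
            (λ n<i → cancel _ _ (≡.trans (≡.sym (P≡ _)) (≡.trans (P≡0 n<i) (≡.sym (ℤ.*-zeroʳ (+ l))))))
            K≡0
            (λ i → cancelℚ _ _ (≡.trans (≡.sym (toℚ-* (+ l) (P′ i))) (≡.trans (≡.cong toℚ (≡.sym (P≡ i)))
              (≡.trans (prop i) (≡.trans (≡.cong (λ z → toℚ z ℚ.* p i) (P≡ n))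
                (≡.trans (≡.cong (ℚ._* p i) (toℚ-* (+ l) (P′ n))) (ℚ.*-assoc (toℚ (+ l)) (toℚ (P′ n)) (p i))))))))
            (λ i → cancel _ _ (≡.trans (shift i) (≡.trans (ℤSeq.conv-cong P≡ (λ j → ≡.sym (ℤ.*-identityˡ (K j))) i)
              (≡.trans (ℤSeq.conv-scale P′ K (+ l) (+ 1) i) (≡.cong (ℤ._* ℤSeq.conv P′ K i) (ℤ.*-identityʳ (+ l)))))))
            κ
      ; (inj₂ l∣K) → let (K′ , K≡) = divide K l∣K in
          integral-factor pls P K′ P≡0
            (λ k<i → cancel _ _ (≡.trans (≡.sym (K≡ _)) (≡.trans (K≡0 k<i) (≡.sym (ℤ.*-zeroʳ (+ l))))))
            prop
            (λ i → cancel _ _ (≡.trans (shift i) (≡.trans (ℤSeq.conv-cong (λ j → ≡.sym (ℤ.*-identityˡ (P j))) K≡ i)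
              (≡.trans (ℤSeq.conv-scale P K′ (+ 1) (+ l) i) (≡.cong (ℤ._* ℤSeq.conv P K′ i) (ℤ.*-identityˡ (+ l)))))))
            κ }
    where
    instance
      l≢0 : ℕ.NonZero l
      l≢0 = prime⇒nonZero pl
    shift : ∀ i → + l ℤ.* (+ product ls ℤ.* f i) ≡ ℤSeq.conv P K i
    shift i = ≡.trans (≡.sym (ℤ.*-assoc (+ l) (+ product ls) (f i)))
      (≡.trans (≡.cong (ℤ._* f i) (≡.sym (ℤ.pos-* l (product ls)))) (f≡PK i))
    l∣PK : ∀ i → + l ∣ℤ ℤSeq.conv P K i
    l∣PK i = divides (+ product ls ℤ.* f i) (≡.trans (≡.sym (shift i)) (ℤ.*-comm (+ l) _))
    divide : ∀ F → (∀ i → + l ∣ℤ F i) → ∃ λ F′ → ∀ i → F i ≡ + l ℤ.* F′ i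
    divide F l∣F = (λ i → ℤ∣._∣_.quotient (l∣F i))
                 , λ i → ≡.trans (ℤ∣._∣_.equality (l∣F i)) (ℤ.*-comm _ (+ l))
    cancel : ∀ x y → + l ℤ.* x ≡ + l ℤ.* y → x ≡ y
    cancel x y = ℤ.*-cancelˡ-≡ (+ l) x y
    cancelℚ : ∀ x y → toℚ (+ l) ℚ.* x ≡ toℚ (+ l) ℚ.* y → x ≡ y
    cancelℚ x y = ℚ-cancelˡ λ l≡0 → ℕ.≢-nonZero⁻¹ l (ℤ.+-injective (toℚ-injective l≡0))

monic-factor-integral : ∀ n p → p n ≡ ℚ.1ℚ → ℚSeq.VanishesFrom (suc n) p →
  ∀ k g → ℚSeq.VanishesFrom (suc k) g → ∀ f → f (n ℕ.+ k) ≡ + 1 →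
  (∀ i → toℚ (f i) ≡ ℚSeq.conv p g i) → ¬ ¬ Integral p
monic-factor-integral n p p≡1 p≡0 k g g≡0 f f≡1 f≡pg =
  let (d , P , d≢0 , P≡) = clear-denominators (suc n) p p≡0
      (e , K , e≢0 , K≡) = clear-denominators (suc k) g g≡0
      open PrimeFactorisation (factorise (d ℕ.* e) {{ℕ.m*n≢0 d e {{d≢0}} {{e≢0}}}})
      -- Because p is monic, the cleared denominator d is the leading coefficient of P, as
      -- proportionality requires.
      Pₙ≡d : toℚ (P n) ≡ toℚ (+ d)
      Pₙ≡d = ≡.trans (P≡ n) (≡.trans (≡.cong (toℚ (+ d) ℚ.*_) p≡1) (ℚ.*-identityʳ _))
      f≡PK : ∀ i → + (d ℕ.* e) ℤ.* f i ≡ ℤSeq.conv P K i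
      f≡PK i = toℚ-injective (begin
        toℚ (+ (d ℕ.* e) ℤ.* f i)                        ≡⟨ toℚ-* (+ (d ℕ.* e)) (f i) ⟩
        toℚ (+ (d ℕ.* e)) ℚ.* toℚ (f i)                  ≡⟨ ≡.cong₂ ℚ._*_ (≡.trans (≡.cong toℚ (ℤ.pos-* d e)) (toℚ-* (+ d) (+ e))) (f≡pg i) ⟩
        toℚ (+ d) ℚ.* toℚ (+ e) ℚ.* ℚSeq.conv p g i      ≡⟨ ℚSeq.conv-scale p g (toℚ (+ d)) (toℚ (+ e)) i ⟨
        ℚSeq.conv _ _ i                                  ≡⟨ ℚSeq.conv-cong P≡ K≡ i ⟨
        ℚSeq.conv (toℚ ∘ P) (toℚ ∘ K) i                  ≡⟨ toℚ-conv P K i ⟨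
        toℚ (ℤSeq.conv P K i)                            ∎)
  in integral-factor p f n k f≡1 factorsPrime P K (vanish d p P P≡ p≡0) (vanish e g K K≡ g≡0)
       (λ i → ≡.trans (P≡ i) (≡.cong (ℚ._* p i) (≡.sym Pₙ≡d)))
       (λ i → ≡.trans (≡.cong (λ m → + m ℤ.* f i) (≡.sym isFactorisation)) (f≡PK i))
  where
  open ≡.≡-Reasoning
  vanish : ∀ {m} c h H → (∀ i → toℚ (H i) ≡ toℚ (+ c) ℚ.* h i) →
    ℚSeq.VanishesFrom m h → ℤSeq.VanishesFrom m H
  vanish c h H H≡ h≡0 {i} m≤i = toℚ-injective {H i} {+ 0}
    (≡.trans (H≡ i) (≡.trans (≡.cong (toℚ (+ c) ℚ.*_) (h≡0 m≤i)) (ℚ.*-zeroʳ (toℚ (+ c)))))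

-- Passage between monic vectors and coefficient sequences

toVec : ∀ {A : Set} n → (ℕ → A) → Vec A n
toVec zero    f = []
toVec (suc n) f = f 0 ∷ toVec n (f ∘ suc)

map-toVec : ∀ {A B : Set} (h : A → B) n f → map h (toVec n f) ≡ toVec n (h ∘ f)
map-toVec h zero    f = ≡.refl
map-toVec h (suc n) f = ≡.cong (h (f 0) ∷_) (map-toVec h n (f ∘ suc))

module _ {A : Set} (0# 1# : A) where

  coefficients : ∀ {n} → Vec A n → ℕ → A
  coefficients []       zero    = 1#
  coefficients []       (suc i) = 0#
  coefficients (a ∷ as) zero    = a
  coefficients (a ∷ as) (suc i) = coefficients as i

  coefficients-leading : ∀ {n} (as : Vec A n) → coefficients as n ≡ 1#
  coefficients-leading []       = ≡.refl
  coefficients-leading (a ∷ as) = coefficients-leading as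

  coefficients-vanish : ∀ {n} (as : Vec A n) → ∀ {i} → suc n ℕ.≤ i → coefficients as i ≡ 0#
  coefficients-vanish []       (ℕ.s≤s _)   = ≡.refl
  coefficients-vanish (a ∷ as) (ℕ.s≤s n<i) = coefficients-vanish as n<i

ℚcoeffs : ∀ {n} → Vec ℚ n → ℕ → ℚ
ℚcoeffs = coefficients ℚ.0ℚ ℚ.1ℚ

ℤcoeffs : ∀ {n} → Vec ℤ n → ℕ → ℤ
ℤcoeffs = coefficients (+ 0) (+ 1)

toℚ-coefficients : ∀ {n} (as : Vec ℤ n) i → toℚ (ℤcoeffs as i) ≡ ℚcoeffs (map toℚ as) i
toℚ-coefficients []       zero    = ≡.refl
toℚ-coefficients []       (suc i) = ≡.refl
toℚ-coefficients (a ∷ as) zero    = ≡.refl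
toℚ-coefficients (a ∷ as) (suc i) = toℚ-coefficients as i

-- The rationals inside the reals

module RationalEmbedding (R : CompleteOrderedField) where
  open Pisot R
  open OrderedField R
  open import Relation.Binary.Reasoning.Setoid setoid
  module ℝSeq = CoefficientSequences commutativeRing

  fromℕ≉0 : ∀ n → ¬ (fromℕ (suc n) ≈ 0#)
  fromℕ≉0 n = >⇒≉ (fromℕ-pos n)

  *-cancelʳ-≈ : ∀ {x y z} → 0# < z → x * z ≈ y * z → x ≈ y
  *-cancelʳ-≈ 0<z eq = ≤-antisym (*-cancelʳ-≤ 0<z (≤-reflexive eq)) (*-cancelʳ-≤ 0<z (≤-reflexive (sym eq)))

  fromℚ-↧ : ∀ q → fromℚ q * fromℤ (↧ q) ≈ fromℤ (↥ q)
  fromℚ-↧ q@(ℚ.mkℚ n d _) = trans (*-assoc _ _ _)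
    (trans (*-congˡ (trans (*-comm _ _) (*-inverseʳ _ (fromℕ≉0 d)))) (*-identityʳ _))

  -- The fraction n/(d + 1) may be unreduced, which is how sums and products of rationals arise
  -- before cancellation.
  fromℚ-≃ : ∀ q n d → toℚᵘ q ℚᵘ.≃ ℚᵘ.mkℚᵘ n d → fromℚ q * fromℕ (suc d) ≈ fromℤ n
  fromℚ-≃ q@(ℚ.mkℚ a b _) n d (ℚᵘ.*≡* eq) = *-cancelʳ-≈ (fromℕ-pos b) (begin
    fromℚ q * fromℕ (suc d) * fromℕ (suc b) ≈⟨ solve 3 (λ q d b → q :* d :* b := q :* b :* d) refl (fromℚ q) _ _ ⟩
    fromℚ q * fromℕ (suc b) * fromℕ (suc d) ≈⟨ *-congʳ (fromℚ-↧ q) ⟩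
    fromℤ a * fromℕ (suc d)                 ≈⟨ fromℤ-* a (+ suc d) ⟨
    fromℤ (a ℤ.* + suc d)                   ≡⟨ ≡.cong fromℤ eq ⟩
    fromℤ (n ℤ.* + suc b)                   ≈⟨ fromℤ-* n (+ suc b) ⟩
    fromℤ n * fromℕ (suc b)                 ∎)

  fromℚ-+ : ∀ p q → fromℚ (p ℚ.+ q) ≈ fromℚ p + fromℚ q
  fromℚ-+ p@(ℚ.mkℚ a b _) q@(ℚ.mkℚ c d _) = *-cancelʳ-≈ (fromℕ-pos (d ℕ.+ b ℕ.* suc d)) (begin
    fromℚ (p ℚ.+ q) * fromℕ (suc b ℕ.* suc d)      ≈⟨ fromℚ-≃ (p ℚ.+ q) _ _ (ℚ.toℚᵘ-homo-+ p q) ⟩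
    fromℤ (a ℤ.* + suc d ℤ.+ c ℤ.* + suc b)        ≈⟨ fromℤ-+ (a ℤ.* + suc d) (c ℤ.* + suc b) ⟩
    fromℤ (a ℤ.* + suc d) + fromℤ (c ℤ.* + suc b)  ≈⟨ +-cong (fromℤ-* a (+ suc d)) (fromℤ-* c (+ suc b)) ⟩
    fromℤ a * D + fromℤ c * B                      ≈⟨ +-cong (*-congʳ (sym (fromℚ-↧ p))) (*-congʳ (sym (fromℚ-↧ q))) ⟩
    fromℚ p * B * D + fromℚ q * D * B              ≈⟨ solve 4 (λ p q b d → p :* b :* d :+ q :* d :* b
                                                        := (p :+ q) :* (b :* d)) refl (fromℚ p) (fromℚ q) B D ⟩
    (fromℚ p + fromℚ q) * (B * D)                  ≈⟨ *-congˡ (fromℕ-* (suc b) (suc d)) ⟨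
    (fromℚ p + fromℚ q) * fromℕ (suc b ℕ.* suc d)  ∎)
    where
    B = fromℕ (suc b)
    D = fromℕ (suc d)

  fromℚ-* : ∀ p q → fromℚ (p ℚ.* q) ≈ fromℚ p * fromℚ q
  fromℚ-* p@(ℚ.mkℚ a b _) q@(ℚ.mkℚ c d _) = *-cancelʳ-≈ (fromℕ-pos (d ℕ.+ b ℕ.* suc d)) (begin
    fromℚ (p ℚ.* q) * fromℕ (suc b ℕ.* suc d)      ≈⟨ fromℚ-≃ (p ℚ.* q) _ _ (ℚ.toℚᵘ-homo-* p q) ⟩
    fromℤ (a ℤ.* c)                                ≈⟨ fromℤ-* a c ⟩
    fromℤ a * fromℤ c                              ≈⟨ *-cong (sym (fromℚ-↧ p)) (sym (fromℚ-↧ q)) ⟩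
    (fromℚ p * B) * (fromℚ q * D)                  ≈⟨ solve 4 (λ p q b d → (p :* b) :* (q :* d)
                                                        := (p :* q) :* (b :* d)) refl (fromℚ p) (fromℚ q) B D ⟩
    (fromℚ p * fromℚ q) * (B * D)                  ≈⟨ *-congˡ (fromℕ-* (suc b) (suc d)) ⟨
    (fromℚ p * fromℚ q) * fromℕ (suc b ℕ.* suc d)  ∎)
    where
    B = fromℕ (suc b)
    D = fromℕ (suc d)

  fromℚ-toℚ : ∀ z → fromℚ (toℚ z) ≈ fromℤ z
  fromℚ-toℚ z = trans (sym (trans (*-congˡ fromℕ-1) (*-identityʳ _)))
    (fromℚ-≃ (toℚ z) z 0 (toℚᵘ-toℚ z))

  fromℚ-0 : fromℚ ℚ.0ℚ ≈ 0#
  fromℚ-0 = fromℚ-toℚ (+ 0)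

  fromℚ-1 : fromℚ ℚ.1ℚ ≈ 1#
  fromℚ-1 = trans (fromℚ-toℚ (+ 1)) fromℕ-1

  fromℚ-conv : ∀ f g i → fromℚ (ℚSeq.conv f g i) ≈ ℝSeq.conv (fromℚ ∘ f) (fromℚ ∘ g) i
  fromℚ-conv f g zero    = fromℚ-* (f 0) (g 0)
  fromℚ-conv f g (suc i) = trans (fromℚ-+ (f 0 ℚ.* g (suc i)) _)
    (+-cong (fromℚ-* (f 0) (g (suc i))) (fromℚ-conv (f ∘ suc) g i))

  fromℚ-vanish : ∀ {n f} → ℚSeq.VanishesFrom n f → ℝSeq.VanishesFrom n (fromℚ ∘ f)
  fromℚ-vanish f≡0 n≤i = trans (reflexive (≡.cong fromℚ (f≡0 n≤i))) fromℚ-0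

  evalℚ : ℕ → (ℕ → ℚ) → ℝ → ℝ
  evalℚ n f x = ℝSeq.eval n (fromℚ ∘ f) x

-- Minimal polynomials: integrality, constant term, simple roots

module MinimalPolynomials (R : CompleteOrderedField) where
  open Pisot R
  open OrderedField R
  open ComplexNumbers R
  open ComplexPolynomials R
  open RationalEmbedding R
  open ℝSeq using (pow)
  open import Relation.Binary.Reasoning.Setoid setoid

  private
    horner : ∀ a x y → ofReal a +ᶜ ofReal x *ᶜ ofReal y ≈ᶜ ofReal (a + x * y)
    horner a x y = ℂR.trans (ℂR.+-congˡ (ℂR.sym (ofReal-* x y))) (refl , +-identityʳ 0#)

  eval-coefficients : ∀ {n} (p : MonicPoly ℚ n) x →
    eval p (ofReal x) ≈ᶜ ofReal (evalℚ (suc n) (ℚcoeffs p) x)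
  eval-coefficients [] x = trans (sym fromℚ-1) (sym (trans (+-congˡ (zeroʳ x)) (+-identityʳ _))) , refl
  eval-coefficients (a ∷ p) x =
    ℂR.trans (ℂR.+-congˡ (ℂR.*-congˡ (eval-coefficients p x))) (horner _ x _)

  eval-toVec : ∀ n f x → eval (toVec n f) (ofReal x) ≈ᶜ ofReal (evalℚ n f x + pow x n)
  eval-toVec zero    f x = sym (+-identityˡ 1#) , refl
  eval-toVec (suc n) f x = ℂR.trans (ℂR.+-congˡ (ℂR.*-congˡ (eval-toVec n (f ∘ suc) x)))
    (ℂR.trans (horner _ x _)
      (solve 4 (λ a x y p → a :+ x :* (y :+ p) := (a :+ x :* y) :+ x :* p) refl _ x _ _ , refl))

  module _ (q : ℝ) (n : ℕ)
           (minimal : ∀ {k} → k ℕ.< n → (r : MonicPoly ℚ k) → ¬ Root r (ofReal q)) where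

    -- A relation with nonzero top coefficient r k, divided by r k, is a monic polynomial of degree
    -- k < n with root q, against minimality. So the top coefficient is 0 and the relation shortens.
    powers-independent : ∀ k → k ℕ.≤ n → ∀ r → evalℚ k r q ≈ 0# → ∀ {i} → i ℕ.< k → r i ≡ ℚ.0ℚ
    powers-independent (suc k) k<n r r≈0 {i} i<1+k with r k ℚ.≟ ℚ.0ℚ
    ... | yes rₖ≡0 = case ℕ.m≤n⇒m<n∨m≡n (ℕ.≤-pred i<1+k) of λ
      { (inj₁ i<k) → powers-independent k (ℕ.<⇒≤ k<n) r (trans (sym (begin
          evalℚ (suc k) r q                     ≈⟨ ℝSeq.eval-top k (fromℚ ∘ r) q ⟩
          evalℚ k r q + fromℚ (r k) * pow q k   ≈⟨ +-congˡ (*-congʳ (trans (reflexive (≡.cong fromℚ rₖ≡0)) fromℚ-0)) ⟩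
          evalℚ k r q + 0# * pow q k            ≈⟨ solve 2 (λ e p → e :+ con (+ 0) :* p := e) refl _ _ ⟩
          evalℚ k r q                           ∎)) r≈0) i<k
      ; (inj₂ ≡.refl) → rₖ≡0 }
    ... | no rₖ≢0 = contradiction root (minimal k<n (toVec k s))
      where
      instance _ = ℚ.≢-nonZero rₖ≢0
      c = ℚ.1/ r k
      s = λ i → c ℚ.* r i
      crₖ≈1 : fromℚ c * fromℚ (r k) ≈ 1#
      crₖ≈1 = trans (sym (fromℚ-* c (r k))) (trans (reflexive (≡.cong fromℚ (ℚ.*-inverseˡ (r k)))) fromℚ-1)
      scale : evalℚ k s q + pow q k ≈ 0#
      scale = begin
        evalℚ k s q + pow q k
          ≈⟨ +-congʳ (trans (ℝSeq.eval-cong k q (λ i → trans (fromℚ-* c (r i))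
               (solve 2 (λ c r → c :* r := c :* r :+ con (+ 0) :* r) refl (fromℚ c) (fromℚ (r i)))))
               (ℝSeq.eval-linear k (fromℚ ∘ r) (fromℚ ∘ r) (fromℚ c) 0# q)) ⟩
        fromℚ c * E + 0# * E + pow q k
          ≈⟨ solve 3 (λ c e p → c :* e :+ con (+ 0) :* e :+ p := c :* e :+ con (+ 1) :* p) refl (fromℚ c) E (pow q k) ⟩
        fromℚ c * E + 1# * pow q k
          ≈⟨ +-congˡ (*-congʳ (sym crₖ≈1)) ⟩
        fromℚ c * E + fromℚ c * fromℚ (r k) * pow q k
          ≈⟨ solve 4 (λ c e r p → c :* e :+ c :* r :* p := c :* (e :+ r :* p)) refl (fromℚ c) E (fromℚ (r k)) (pow q k) ⟩
        fromℚ c * (E + fromℚ (r k) * pow q k)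
          ≈⟨ *-congˡ (trans (sym (ℝSeq.eval-top k (fromℚ ∘ r) q)) r≈0) ⟩
        fromℚ c * 0#
          ≈⟨ zeroʳ _ ⟩
        0# ∎
        where E = evalℚ k r q
      root : Root (toVec k s) (ofReal q)
      root = ℂR.trans (eval-toVec k s q) (scale , refl)

    module _ (p : MonicPoly ℚ n) (p≈0 : Root p (ofReal q)) where

      evalℚ-p≈0 : evalℚ (suc n) (ℚcoeffs p) q ≈ 0#
      evalℚ-p≈0 = proj₁ (ℂR.trans (ℂR.sym (eval-coefficients p q)) p≈0)

      private
        degree-split : ∀ {N} → n ℕ.≤ N → ∃ λ k → N ≡ k ℕ.+ n
        degree-split {N} n≤N = N ℕ.∸ n , ≡.sym (ℕ.m∸n+n≡m n≤N)

      -- Divide an integral monic F with F(q) = 0 by P. The remainder has n coefficients and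
      -- vanishes at q, so it is zero by independence of the powers; then Gauss's lemma applies to F
      -- = P g.
      minimal-polynomial-integral : AlgebraicInteger (ofReal q) → ¬ ¬ Integral (ℚcoeffs p)
      minimal-polynomial-integral (N , f , f≈0) κ with ℕ.<-≤-connex N n
      ... | inj₁ N<n = minimal N<n (fromℤ[X] f) f≈0
      ... | inj₂ n≤N with degree-split n≤N
      ...   | k , ≡.refl = monic-factor-integral n P P≡1 P≡0 k g g≡0 (ℤcoeffs f)
                (≡.trans (≡.cong (ℤcoeffs f) (ℕ.+-comm n k)) (coefficients-leading _ _ f))
                (λ i → ≡.trans (toℚ-coefficients f i) (F≡Pg i)) κ
        where
        P = ℚcoeffs p
        P≡1 = coefficients-leading ℚ.0ℚ ℚ.1ℚ p
        P≡0 : ℚSeq.VanishesFrom (suc n) P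
        P≡0 = coefficients-vanish ℚ.0ℚ ℚ.1ℚ p
        F = ℚcoeffs (fromℤ[X] f)
        F≡0 : ℚSeq.VanishesFrom (suc (k ℕ.+ n)) F
        F≡0 = coefficients-vanish ℚ.0ℚ ℚ.1ℚ (fromℤ[X] f)
        division = ℚSeq.monic-quotient n P P≡1 P≡0 k F (coefficients-leading ℚ.0ℚ ℚ.1ℚ (fromℤ[X] f)) F≡0
        g = proj₁ division
        g≡0 : ℚSeq.VanishesFrom (suc k) g
        g≡0 = proj₁ (proj₂ division)
        r : ℕ → ℚ
        r i = F i ℚ.- ℚSeq.conv P g i
        -≡0 : ∀ {x y : ℚ} → x ≡ y → x ℚ.- y ≡ ℚ.0ℚ
        -≡0 {x} ≡.refl = ℚ.+-inverseʳ x
        r≡0 : ℚSeq.VanishesFrom n r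
        r≡0 n≤i = -≡0 (proj₂ (proj₂ division) n≤i)
        -- `eval-conv` adds the lengths n + 1 and k + 1, one more than F requires; all evaluations
        -- are padded with zeros to this common length.
        m = suc n ℕ.+ suc k
        n≤m : n ℕ.≤ m
        n≤m = ℕ.≤-trans (ℕ.n≤1+n n) (ℕ.m≤m+n (suc n) (suc k))
        k+n<m : suc (k ℕ.+ n) ℕ.≤ m
        k+n<m = ℕ.s≤s (ℕ.≤-trans (ℕ.≤-reflexive (ℕ.+-comm k n)) (ℕ.+-monoʳ-≤ n (ℕ.n≤1+n k)))
        Fq≈0 : evalℚ m F q ≈ 0#
        Fq≈0 = trans (ℝSeq.eval-extend (fromℚ ∘ F) q k+n<m (fromℚ-vanish F≡0))
          (proj₁ (ℂR.trans (ℂR.sym (eval-coefficients (fromℤ[X] f) q)) f≈0))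
        Pgq≈0 : evalℚ m (ℚSeq.conv P g) q ≈ 0#
        Pgq≈0 = trans (ℝSeq.eval-cong m q (fromℚ-conv P g))
          (trans (ℝSeq.eval-conv (suc n) (suc k) (fromℚ ∘ P) (fromℚ ∘ g) q (fromℚ-vanish P≡0) (fromℚ-vanish g≡0))
            (trans (*-congʳ evalℚ-p≈0) (zeroˡ _)))
        r+Pg : ∀ i → fromℚ (F i) ≈ 1# * fromℚ (r i) + 1# * fromℚ (ℚSeq.conv P g i)
        r+Pg i = trans (reflexive (≡.cong fromℚ (≡.sym (ℚ+.//-rightDividesˡ (ℚSeq.conv P g i) (F i)))))
          (trans (fromℚ-+ (r i) (ℚSeq.conv P g i)) (+-cong (sym (*-identityˡ _)) (sym (*-identityˡ _))))
        rq≈0 : evalℚ n r q ≈ 0#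
        rq≈0 = begin
          evalℚ n r q                                            ≈⟨ ℝSeq.eval-extend (fromℚ ∘ r) q n≤m (fromℚ-vanish r≡0) ⟨
          evalℚ m r q                                            ≈⟨ solve 1 (λ r → r := con (+ 1) :* r :+ con (+ 1) :* con (+ 0)) refl _ ⟩
          1# * evalℚ m r q + 1# * 0#                             ≈⟨ +-congˡ (*-congˡ Pgq≈0) ⟨
          1# * evalℚ m r q + 1# * evalℚ m (ℚSeq.conv P g) q      ≈⟨ ℝSeq.eval-linear m (fromℚ ∘ r) (fromℚ ∘ ℚSeq.conv P g) 1# 1# q ⟨
          ℝSeq.eval m (λ i → 1# * fromℚ (r i) + 1# * fromℚ (ℚSeq.conv P g i)) q
                                                                 ≈⟨ ℝSeq.eval-cong m q r+Pg ⟨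
          evalℚ m F q                                            ≈⟨ Fq≈0 ⟩
          0#                                                     ∎
        F≡Pg : ∀ i → F i ≡ ℚSeq.conv P g i
        F≡Pg i with ℕ.<-≤-connex i n
        ... | inj₂ n≤i = proj₂ (proj₂ division) n≤i
        ... | inj₁ i<n = ≡.trans (≡.sym (ℚ+.//-rightDividesˡ (ℚSeq.conv P g i) (F i)))
            (≡.trans (≡.cong (ℚ._+ ℚSeq.conv P g i) (powers-independent n ℕ.≤-refl r rq≈0 i<n))
              (ℚ.+-identityˡ _))

      0<degree : 0 ℕ.< n
      0<degree = nonconstant p p≈0
        where
        nonconstant : ∀ {m} (r : MonicPoly ℚ m) → Root r (ofReal q) → 0 ℕ.< m
        nonconstant []      (1≈0 , _) = contradiction 1≈0 (>⇒≉ 0<1)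
        nonconstant (_ ∷ _) _         = ℕ.s≤s ℕ.z≤n

      -- If the constant term were 0, dividing by q would leave a relation among 1, ..., qⁿ⁻¹ with
      -- top coefficient 1.
      constant-coefficient≢0 : 0# < q → ¬ (ℚcoeffs p 0 ≡ ℚ.0ℚ)
      constant-coefficient≢0 0<q p₀≡0 = nonzero 0<degree
        where
        tail≈0 : evalℚ n (ℚcoeffs p ∘ suc) q ≈ 0#
        tail≈0 = *-cancelˡ-≈0 (>⇒≉ 0<q) (trans (sym (+-identityˡ _))
          (trans (+-congʳ (sym (trans (reflexive (≡.cong fromℚ p₀≡0)) fromℚ-0))) evalℚ-p≈0))
        nonzero : 0 ℕ.< n → ⊥
        nonzero 0<n = case ≡.trans (≡.sym (coefficients-leading ℚ.0ℚ ℚ.1ℚ p))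
          (≡.subst (λ i → ℚcoeffs p i ≡ ℚ.0ℚ) (ℕ.suc-pred n {{ℕ.>-nonZero 0<n}})
            (powers-independent n ℕ.≤-refl (ℚcoeffs p ∘ suc) tail≈0
              (ℕ.≤-reflexive (ℕ.suc-pred n {{ℕ.>-nonZero 0<n}})))) of λ ()

      derivative : ℕ → ℚ
      derivative i = toℚ (+ suc i) ℚ.* ℚcoeffs p (suc i)

      -- The derivative is a relation among 1, ..., qⁿ⁻¹ whose top coefficient is n, which is
      -- nonzero in ℚ.
      derivative-nonzero : ¬ (evalℚ n derivative q ≈ 0#)
      derivative-nonzero D≈0 = nonzero 0<degree
        where
        nonzero : 0 ℕ.< n → ⊥
        nonzero 0<n = case toℚ-injective {+ suc (ℕ.pred n)} {+ 0} (≡.trans (≡.sym top) (powers-independent n ℕ.≤-refl derivative D≈0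
            (ℕ.≤-reflexive eq))) of λ ()
          where
          eq = ℕ.suc-pred n {{ℕ.>-nonZero 0<n}}
          top : derivative (ℕ.pred n) ≡ toℚ (+ suc (ℕ.pred n))
          top = ≡.trans (≡.cong (toℚ (+ suc (ℕ.pred n)) ℚ.*_)
            (≡.trans (≡.cong (ℚcoeffs p) eq) (coefficients-leading ℚ.0ℚ ℚ.1ℚ p))) (ℚ.*-identityʳ _)

  -- As y is the inverse of x, multiplying the value at x by yⁿ reverses the coefficients. The term
  -- with α 0 stands apart because it becomes the implicit leading term of a monic vector once c α 0
  -- = 1.
  reversed-eval : ∀ (α : ℕ → ℝ) c x y → x * y ≈ 1# → ∀ n →
    ℝSeq.eval n (λ j → c * α (n ℕ.∸ j)) y + c * α 0 * pow y n
      ≈ c * pow y n * ℝSeq.eval (suc n) α x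
  reversed-eval α c x y xy≈1 zero = solve 3 (λ c a x →
    con (+ 0) :+ c :* a :* con (+ 1) := c :* con (+ 1) :* (a :+ x :* con (+ 0))) refl c (α 0) x
  reversed-eval α c x y xy≈1 (suc n) = begin
    c * α (suc n) + y * E + c * α 0 * (y * pow y n)
      ≈⟨ solve 5 (λ u y e v p → u :+ y :* e :+ v :* (y :* p) := u :+ y :* (e :+ v :* p)) refl
           (c * α (suc n)) y E (c * α 0) (pow y n) ⟩
    c * α (suc n) + y * (E + c * α 0 * pow y n)
      ≈⟨ +-cong (trans (sym (*-identityʳ _)) (*-congˡ (sym (pow-inverse (suc n)))))
                (*-congˡ (reversed-eval α c x y xy≈1 n)) ⟩
    c * α (suc n) * (pow x (suc n) * pow y (suc n)) + y * (c * pow y n * F)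
      ≈⟨ solve 6 (λ c a X y p F → c :* a :* (X :* (y :* p)) :+ y :* (c :* p :* F)
           := c :* (y :* p) :* (F :+ a :* X)) refl c (α (suc n)) (pow x (suc n)) y (pow y n) F ⟩
    c * pow y (suc n) * (F + α (suc n) * pow x (suc n))
      ≈⟨ *-congˡ (ℝSeq.eval-top (suc n) α x) ⟨
    c * pow y (suc n) * ℝSeq.eval (suc (suc n)) α x ∎
    where
    E = ℝSeq.eval n (λ j → c * α (n ℕ.∸ j)) y
    F = ℝSeq.eval (suc n) α x
    pow-inverse : ∀ k → pow x k * pow y k ≈ 1#
    pow-inverse zero    = *-identityˡ 1#
    pow-inverse (suc k) = begin
      x * pow x k * (y * pow y k) ≈⟨ solve 4 (λ x p y r → x :* p :* (y :* r) := (x :* y) :* (p :* r)) refl x _ y _ ⟩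
      x * y * (pow x k * pow y k) ≈⟨ *-cong xy≈1 (pow-inverse k) ⟩
      1# * 1#                     ≈⟨ *-identityˡ 1# ⟩
      1#                          ∎

  -- The inverse of q is a root of the reversed polynomial, made monic by the
  -- factor a₀ = ±1.
  constant±1⇒unit : ∀ {n} (p : MonicPoly ℚ n) q → 0# < q → Root p (ofReal q) → AlgebraicInteger (ofReal q) →
    ∀ (a : ℕ → ℤ) → (∀ i → toℚ (a i) ≡ ℚcoeffs p i) → a 0 ℤ.* a 0 ≡ + 1 → AlgebraicUnit (ofReal q)
  constant±1⇒unit {n} p q 0<q p≈0 integer a a≡p a₀²≡1 =
    integer , ofReal w , (n , toVec n rev , root) ,
      ℂR.trans (ℂR.sym (ofReal-* q w)) (qw≈1 , refl)
    where
    w = q ⁻¹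
    qw≈1 = *-inverseʳ q (>⇒≉ 0<q)
    rev : ℕ → ℤ
    rev j = a 0 ℤ.* a (n ℕ.∸ j)
    α : ℕ → ℝ
    α i = fromℤ (a i)
    αq≈0 : ℝSeq.eval (suc n) α q ≈ 0#
    αq≈0 = trans (ℝSeq.eval-cong (suc n) q (λ i → trans (sym (fromℚ-toℚ (a i))) (reflexive (≡.cong fromℚ (a≡p i)))))
      (proj₁ (ℂR.trans (ℂR.sym (eval-coefficients p q)) p≈0))
    a₀²≈1 : α 0 * α 0 ≈ 1#
    a₀²≈1 = trans (sym (fromℤ-* (a 0) (a 0))) (trans (reflexive (≡.cong fromℤ a₀²≡1)) fromℕ-1)
    value : evalℚ n (toℚ ∘ rev) w + pow w n ≈ 0#
    value = begin
      evalℚ n (toℚ ∘ rev) w + pow w n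
        ≈⟨ +-cong (ℝSeq.eval-cong n w (λ j → trans (fromℚ-toℚ (rev j)) (fromℤ-* (a 0) (a (n ℕ.∸ j)))))
             (trans (sym (*-identityˡ _)) (*-congʳ (sym a₀²≈1))) ⟩
      ℝSeq.eval n (λ j → α 0 * α (n ℕ.∸ j)) w + α 0 * α 0 * pow w n
        ≈⟨ reversed-eval α (α 0) q w qw≈1 n ⟩
      α 0 * pow w n * ℝSeq.eval (suc n) α q
        ≈⟨ *-congˡ αq≈0 ⟩
      α 0 * pow w n * 0#
        ≈⟨ zeroʳ _ ⟩
      0# ∎
    root : Root (fromℤ[X] (toVec n rev)) (ofReal w)
    root = ≡.subst (λ v → Root v (ofReal w)) (≡.sym (map-toVec toℚ n rev))
      (ℂR.trans (eval-toVec n (toℚ ∘ rev) w) (value , refl))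

  toℂ : ∀ {n} → MonicPoly ℚ n → Vec ℂ n
  toℂ = map (ofReal ∘ fromℚ)

  eval-toℂ : ∀ {n} (p : MonicPoly ℚ n) z → evalᶜ (toℂ p) z ≡ eval p z
  eval-toℂ []      z = ≡.refl
  eval-toℂ (a ∷ p) z = ≡.cong (λ w → ofReal (fromℚ a) +ᶜ z *ᶜ w) (eval-toℂ p z)

  formal-derivative : (ℕ → ℝ) → ℕ → ℝ
  formal-derivative α i = fromℕ (suc i) * α (suc i)

  -- The product rule for f = α 0 + X g: f′ = g + X g′.
  eval-derivative : ∀ k α x → ℝSeq.eval (suc k) (formal-derivative α) x
    ≈ ℝSeq.eval (suc k) (α ∘ suc) x + x * ℝSeq.eval k (formal-derivative (α ∘ suc)) x
  eval-derivative k α x = begin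
    fromℕ 1 * α 1 + x * ℝSeq.eval k (formal-derivative α ∘ suc) x
      ≈⟨ +-cong (*-congʳ fromℕ-1) (*-congˡ (trans
           (ℝSeq.eval-cong k x (λ i → solve 2 (λ n a → (con (+ 1) :+ n) :* a := con (+ 1) :* a :+ con (+ 1) :* (n :* a))
              refl (fromℕ (suc i)) (α (suc (suc i)))))
           (ℝSeq.eval-linear k (α ∘ suc ∘ suc) (formal-derivative (α ∘ suc)) 1# 1# x))) ⟩
    1# * α 1 + x * (1# * A + 1# * D)
      ≈⟨ solve 4 (λ a x u d → con (+ 1) :* a :+ x :* (con (+ 1) :* u :+ con (+ 1) :* d) := (a :+ x :* u) :+ x :* d)
           refl (α 1) x A D ⟩
    α 1 + x * A + x * D ∎
    where
    A = ℝSeq.eval k (α ∘ suc ∘ suc) x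
    D = ℝSeq.eval k (formal-derivative (α ∘ suc)) x

  -- The quotient by X - x, evaluated at x, is the derivative at x; both obey the recursion of the
  -- product rule.
  eval-quotient-self : ∀ {n} (p : MonicPoly ℚ (suc n)) x →
    evalᶜ (quotient (toℂ p) (ofReal x)) (ofReal x)
      ≈ᶜ ofReal (ℝSeq.eval (suc n) (formal-derivative (fromℚ ∘ ℚcoeffs p)) x)
  eval-quotient-self (a ∷ []) x = sym (trans (+-cong (*-cong fromℕ-1 fromℚ-1) (zeroʳ x))
    (trans (+-identityʳ _) (*-identityʳ 1#))) , refl
  eval-quotient-self {suc n} (a ∷ p@(_ ∷ _)) x = ℂR.trans
    (ℂR.+-cong (ℂR.trans (ℂR.reflexive (eval-toℂ p (ofReal x))) (eval-coefficients p x))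
      (ℂR.*-congˡ (eval-quotient-self p x)))
    (ℂR.trans (horner _ x _) (sym (eval-derivative (suc n) (fromℚ ∘ ℚcoeffs (a ∷ p)) x) , refl))

-- The lower bound for the conjugates of a Pisot number

module ConjugateBounds (R : CompleteOrderedField) where
  open Pisot R
  open OrderedField R
  open RealInduction R
  open ComplexNumbers R
  open ComplexPolynomials R
  open AlgebraicClosure R
  open RationalEmbedding R
  open MinimalPolynomials R
  open import Relation.Binary.Reasoning.Setoid setoid

  -- Such a y belongs to the set whose supremum is `√ x`. With the next lemma this turns bounds on
  -- moduli into inequalities between squares.
  ²≤⇒≤√ : ∀ {x y} → y * y ≤ x → y ≤ √ x
  ²≤⇒≤√ {x} yy≤x = proj₁ (proj₂ (supremum (SqrtSet x) (0# , inj₂ refl) (sqrtSet-bounded x))) (inj₁ yy≤x)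

  ≤²⇒√≤ : ∀ {x b} → 0# ≤ b → x ≤ b * b → √ x ≤ b
  ≤²⇒√≤ {x} 0≤b x≤bb = proj₂ (proj₂ (supremum (SqrtSet x) (0# , inj₂ refl) (sqrtSet-bounded x)))
    λ { (inj₁ yy≤x) → ²-cancel-≤ 0≤b (≤-trans yy≤x x≤bb)
      ; (inj₂ y≈0)  → ≤-trans (≤-reflexive y≈0) 0≤b }

  ∣∣<1⇒N≤1 : ∀ z → ∣ z ∣ < 1# → N z ≤ 1#
  ∣∣<1⇒N≤1 z ∣z∣<1 = ≮⇒≥ λ 1<N → ≤⇒≯ (²≤⇒≤√ (≤-trans (≤-reflexive (*-identityʳ 1#)) (<⇒≤ 1<N))) ∣z∣<1

  fromℤ-square-≥4 : ∀ a → ¬ (a ≡ + 0) → ¬ (a ℤ.* a ≡ + 1) → fromℕ 4 ≤ fromℤ a * fromℤ a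
  fromℤ-square-≥4 a a≢0 a²≢1 = ≤-trans (fromℕ-mono (4≤ a a≢0 a²≢1)) (≤-reflexive (trans
    (reflexive (≡.cong fromℤ (abs² a))) (fromℤ-* a a)))
    where
    abs² : ∀ a → + (ℤ.∣ a ∣ ℕ.* ℤ.∣ a ∣) ≡ a ℤ.* a
    abs² (+ n)    = ℤ.pos-* n n
    abs² -[1+ n ] = ≡.refl
    4≤ : ∀ a → ¬ (a ≡ + 0) → ¬ (a ℤ.* a ≡ + 1) → 4 ℕ.≤ ℤ.∣ a ∣ ℕ.* ℤ.∣ a ∣
    4≤ (+ 0)             a≢0 _    = contradiction ≡.refl a≢0
    4≤ (+ 1)             _   a²≢1 = contradiction ≡.refl a²≢1
    4≤ (+ suc (suc n))   _   _    = ℕ.*-mono-≤ {2} {suc (suc n)} {2} {suc (suc n)} (ℕ.s≤s (ℕ.s≤s ℕ.z≤n)) (ℕ.s≤s (ℕ.s≤s ℕ.z≤n))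
    4≤ -[1+ 0 ]          _   a²≢1 = contradiction ≡.refl a²≢1
    4≤ -[1+ suc n ]      _   _    = ℕ.*-mono-≤ {2} {suc (suc n)} {2} {suc (suc n)} (ℕ.s≤s (ℕ.s≤s ℕ.z≤n)) (ℕ.s≤s (ℕ.s≤s ℕ.z≤n))

  N-constant-term : ∀ {n} (p : MonicPoly ℚ n) → N (eval p 0ᶜ) ≈ fromℚ (ℚcoeffs p 0) * fromℚ (ℚcoeffs p 0)
  N-constant-term {n} p = trans (N-cong (ℂR.trans (eval-coefficients p 0#)
      (trans (+-congˡ (zeroˡ _)) (+-identityʳ _) , refl)))
    (N-ofReal (fromℚ (ℚcoeffs p 0)))

  module _ (q : ℝ) (pisot : IsPisot q) where
    open IsPisot pisot

    0<q : 0# < q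
    0<q = <-trans 0<1 1<q

    simple-root : ∀ {n} (p : MonicPoly ℚ (suc n)) → IsMinimalPolynomial p (ofReal q) →
      ¬ (evalᶜ (quotient (toℂ p) (ofReal q)) (ofReal q) ≈ᶜ 0ᶜ)
    simple-root {n} p (p≈0 , minimal) Q≈0 = derivative-nonzero q (suc n) minimal p p≈0 (trans
      (ℝSeq.eval-cong (suc n) q (λ i → trans (fromℚ-* (toℚ (+ suc i)) (ℚcoeffs p (suc i))) (*-congʳ (fromℚ-toℚ (+ suc i)))))
      (proj₁ (ℂR.trans (ℂR.sym (eval-quotient-self p q)) Q≈0)))

    N-constant-term-≤ : ∀ {n} (p : MonicPoly ℚ n) → IsMinimalPolynomial p (ofReal q) →
      ∀ q′ → Root p q′ → ¬ (q′ ≈ᶜ ofReal q) → N (eval p 0ᶜ) ≤ q * q * N q′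
    N-constant-term-≤ [] _ q′ 1≈0 _ = contradiction (proj₁ 1≈0) (>⇒≉ 0<1)
    -- In degree 1 the value differences of p are the differences of arguments, so q is its only
    -- root and no q′ remains.
    N-constant-term-≤ (a ∷ []) (p≈0 , _) q′ pq′≈0 q′≉q = contradiction
      (ℂR.trans (difference q′) (ℂR.trans (ℂR.+-cong pq′≈0 (ℂR.-‿cong p≈0)) (ℂR.-‿inverseʳ 0ᶜ)))
      (q′≉q ∘ -≈0⇒≈)
      where
      difference : ∀ z → z -ᶜ ofReal q ≈ᶜ eval (a ∷ []) z -ᶜ eval (a ∷ []) (ofReal q)
      difference z = ℂS.solve 3 (λ z a q → z ℂS.:- q
        ℂS.:= (a ℂS.:+ z ℂS.:* ℂS.con (+ 1)) ℂS.:- (a ℂS.:+ q ℂS.:* ℂS.con (+ 1)))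
        ℂR.refl z (ofReal (fromℚ a)) (ofReal q)
    N-constant-term-≤ {n} p@(_ ∷ _ ∷ _) min@(p≈0 , minimal) q′ pq′≈0 q′≉q =
      ≤-trans (≤-reflexive N≈) (≤-trans (*-mono-≤ (0≤N (evalᶜ S 0ᶜ)) 0≤qqN ≤-refl NS≤1)
        (≤-reflexive (*-identityʳ _)))
      where
      q∈ℂ = ofReal q
      Q = quotient (toℂ p) q∈ℂ
      S = quotient Q q′
      0≤qqN : 0# ≤ q * q * N q′
      0≤qqN = 0≤* (0≤² q) (0≤N q′)
      P-factor : ∀ z → eval p z ≈ᶜ (z -ᶜ q∈ℂ) *ᶜ evalᶜ Q z
      P-factor z = ℂR.trans (ℂR.reflexive (≡.sym (eval-toℂ p z)))
        (ℂR.trans (eval-quotient (toℂ p) q∈ℂ z) (ℂR.trans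
          (ℂR.+-congʳ (ℂR.trans (ℂR.reflexive (eval-toℂ p q∈ℂ)) p≈0)) (ℂR.+-identityˡ _)))
      Qq′≈0 : evalᶜ Q q′ ≈ᶜ 0ᶜ
      Qq′≈0 = case evalᶜ Q q′ ≟0ᶜ of λ
        { (yes Q≈0) → Q≈0
        ; (no Q≉0)  → contradiction (ℂR.trans (ℂR.sym (P-factor q′)) pq′≈0)
                        (*ᶜ-≉0 (q′≉q ∘ -≈0⇒≈) Q≉0) }
      Q-factor : ∀ z → evalᶜ Q z ≈ᶜ (z -ᶜ q′) *ᶜ evalᶜ S z
      Q-factor z = ℂR.trans (eval-quotient Q q′ z) (ℂR.trans (ℂR.+-congʳ Qq′≈0) (ℂR.+-identityˡ _))
      S-roots : ∀ z → evalᶜ S z ≈ᶜ 0ᶜ → N z ≤ 1#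
      S-roots z Sz≈0 = ∣∣<1⇒N≤1 z (conjugates<1 z
        (n , p , min , ℂR.trans (P-factor z) (ℂR.trans (ℂR.*-congˡ Qz≈0) (ℂR.zeroʳ _)))
        -- A root of S is a root of Q = P / (X - q), and Q does not vanish at q because q is simple.
        -- Hence z is a conjugate other than q and lies in the unit disc.
        λ z≈q → simple-root p min (ℂR.trans (evalᶜ-cong Q (ℂR.sym z≈q)) Qz≈0))
        where
        Qz≈0 : evalᶜ Q z ≈ᶜ 0ᶜ
        Qz≈0 = ℂR.trans (Q-factor z) (ℂR.trans (ℂR.*-congˡ Sz≈0) (ℂR.zeroʳ _))
      NS≤1 = constant-term-bounded S S-roots
      N-neg : ∀ z → N (0ᶜ -ᶜ z) ≈ N z
      N-neg (x +i y) = solve 2 (λ x y → (con (+ 0) :- x) :* (con (+ 0) :- x) :+ (con (+ 0) :- y) :* (con (+ 0) :- y)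
        := x :* x :+ y :* y) refl x y
      N≈ : N (eval p 0ᶜ) ≈ q * q * N q′ * N (evalᶜ S 0ᶜ)
      N≈ = begin
        N (eval p 0ᶜ)                                      ≈⟨ N-cong (P-factor 0ᶜ) ⟩
        N ((0ᶜ -ᶜ q∈ℂ) *ᶜ evalᶜ Q 0ᶜ)                      ≈⟨ N-* (0ᶜ -ᶜ q∈ℂ) (evalᶜ Q 0ᶜ) ⟩
        N (0ᶜ -ᶜ q∈ℂ) * N (evalᶜ Q 0ᶜ)                     ≈⟨ *-cong (trans (N-neg q∈ℂ) (N-ofReal q))
                                                               (trans (N-cong (Q-factor 0ᶜ)) (trans (N-* (0ᶜ -ᶜ q′) (evalᶜ S 0ᶜ))
                                                                 (*-congʳ (N-neg q′)))) ⟩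
        q * q * (N q′ * N (evalᶜ S 0ᶜ))                    ≈⟨ *-assoc _ _ _ ⟨
        q * q * N q′ * N (evalᶜ S 0ᶜ)                      ∎

    4≤q²N : ¬ AlgebraicUnit (ofReal q) → ∀ {n} (p : MonicPoly ℚ n) → IsMinimalPolynomial p (ofReal q) →
      ∀ q′ → Root p q′ → ¬ (q′ ≈ᶜ ofReal q) → fromℕ 4 ≤ q * q * N q′
    4≤q²N non-unit {n} p min@(p≈0 , minimal) q′ pq′≈0 q′≉q = ≮⇒≥ λ lt →
      minimal-polynomial-integral q n minimal p p≈0 algebraicInteger λ (a , a≡p) →
      let a₀≢0 = λ a₀≡0 → constant-coefficient≢0 q n minimal p p≈0 0<q
                   (≡.trans (≡.sym (a≡p 0)) (≡.cong toℚ a₀≡0))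
          a₀²≢1 = λ a₀²≡1 → non-unit (constant±1⇒unit p q 0<q p≈0 algebraicInteger a a≡p a₀²≡1)
          a₀≈ = trans (sym (fromℚ-toℚ (a 0))) (reflexive (≡.cong fromℚ (a≡p 0)))
      in ≤⇒≯ (≤-trans (fromℤ-square-≥4 (a 0) a₀≢0 a₀²≢1)
           (≤-trans (≤-reflexive (trans (*-cong a₀≈ a₀≈) (sym (N-constant-term p))))
             (N-constant-term-≤ p min q′ pq′≈0 q′≉q))) lt

  -- The constant 2/(m + 1) and its comparison with the numbers cₘ

  2/ : ℕ → ℝ
  2/ k = fromℕ 2 * fromℕ k ⁻¹

  2/-cancel : ∀ k → 2/ (suc k) * fromℕ (suc k) ≈ fromℕ 2
  2/-cancel k = trans (*-assoc _ _ _) (trans (*-congˡ (trans (*-comm _ _) (*-inverseʳ _ (fromℕ≉0 k)))) (*-identityʳ _))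

  0<2/ : ∀ k → 0# < 2/ (suc k)
  0<2/ k = *-pos (fromℕ-pos 1) (⁻¹-pos (fromℕ-pos k))

  2/-≤1 : ∀ k → 1 ℕ.≤ k → 2/ (suc k) ≤ 1#
  2/-≤1 k 1≤k = *-cancelʳ-≤ (fromℕ-pos k) (≤-cong (sym (2/-cancel k)) (sym (*-identityˡ _)) (fromℕ-mono (ℕ.s≤s 1≤k)))

  conjugate-bound : ∀ k → 1 ℕ.≤ k → ∀ q → q < fromℕ (suc k) → IsPisot q → ¬ AlgebraicUnit (ofReal q) →
    ∀ q′ → GaloisConjugate (ofReal q) q′ → 2/ (suc k) ≤ ∣ q′ ∣
  conjugate-bound k 1≤k q q<1+k pisot non-unit q′ (n , p , min , pq′≈0) =
    case (q′ -ᶜ ofReal q) ≟0ᶜ of λ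
      -- For q itself the number 1 lies between: 2/(k + 1) ≤ 1 < q.
      { (yes q′-q≈0) → ²≤⇒≤√ (≤-trans (*-mono-≤ 0≤B (<⇒≤ 0<1) (2/-≤1 k 1≤k) (2/-≤1 k 1≤k))
          (≤-trans (*-mono-≤ (<⇒≤ 0<1) (<⇒≤ 0<q′) (<⇒≤ 1<q) (<⇒≤ 1<q))
            (≤-reflexive (sym (trans (N-cong (-≈0⇒≈ q′-q≈0)) (N-ofReal q))))))
      ; (no q′≉q) →
          let 4≤ = 4≤q²N q pisot non-unit p min q′ pq′≈0 (q′≉q ∘ λ q′≈q → ℂR.trans (ℂR.+-congʳ q′≈q) (ℂR.-‿inverseʳ _))
              qq≤KK = *-mono-≤ (<⇒≤ 0<q′) (<⇒≤ (fromℕ-pos k)) (<⇒≤ q<1+k) (<⇒≤ q<1+k)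
              4≤KKN = ≤-trans 4≤ (*-monoˡ-≤ (0≤N q′) qq≤KK)
          -- Write 4 as the square of (2/(k + 1)) (k + 1) and cancel (k + 1)².
          in ²≤⇒≤√ (*-cancelʳ-≤ (*-pos (fromℕ-pos k) (fromℕ-pos k)) (≤-cong
               (trans (fromℕ-* 2 2) (trans (sym (*-cong (2/-cancel k) (2/-cancel k)))
                 (solve 2 (λ b k → (b :* k) :* (b :* k) := (b :* b) :* (k :* k)) refl (2/ (suc k)) (fromℕ (suc k)))))
               (*-comm _ _) 4≤KKN)) }
    where
    open IsPisot pisot
    0<q′ = 0<q q pisot
    0≤B = <⇒≤ (0<2/ k)

  half-≤ : ∀ {x y} → x ≤ fromℕ 2 * y → x * fromℕ 2 ⁻¹ ≤ y
  half-≤ {x} {y} x≤2y = ≤-trans (*-monoˡ-≤ (<⇒≤ (⁻¹-pos (fromℕ-pos 1))) x≤2y) (≤-reflexive (trans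
    (solve 3 (λ t y h → t :* y :* h := y :* (t :* h)) refl (fromℕ 2) y (fromℕ 2 ⁻¹))
    (trans (*-congˡ (*-inverseʳ _ (fromℕ≉0 1))) (*-identityʳ y))))

  -- From 5 ≤ 9 follows √5 ≤ 3, so c₁ ≤ 1 = 2/2.
  c₁-bound : (√ fromℕ 5 - 1#) * fromℕ 2 ⁻¹ ≤ 2/ 2
  c₁-bound = half-≤ (≤-trans
    (+-mono-≤ (≤²⇒√≤ {b = fromℕ 3} (fromℕ-nonneg 3) (≤-trans (fromℕ-mono {5} {9} (ℕ.m≤m+n 5 4)) (≤-reflexive (fromℕ-* 3 3)))) ≤-refl)
    (≤-reflexive (trans (solve 0 ((con (+ 1) :+ (con (+ 1) :+ (con (+ 1) :+ con (+ 0)))) :- con (+ 1)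
      := con (+ 1) :+ (con (+ 1) :+ con (+ 0))) refl)
      (trans (sym (2/-cancel 1)) (*-comm _ _)))))

  quartic-value : ∀ x → eval quartic (ofReal (- x))
    ≈ᶜ ofReal (evalʳ (- 1# ∷ 2# ∷ 1# ∷ 1# + 2# ∷ []) x)
  quartic-value x = ℂR.trans (eval-coefficients quartic (- x)) (trans
    (+-cong (fromℚ-toℚ -[1+ 0 ]) (*-congˡ (+-cong (fromℚ-toℚ -[1+ 1 ]) (*-congˡ (+-cong (fromℚ-toℚ (+ 1))
      (*-congˡ (+-cong (fromℚ-toℚ -[1+ 2 ]) (*-congˡ (+-congʳ (fromℚ-toℚ (+ 1)))))))))))
    (solve 1 (λ x → let one = con (+ 1) :+ con (+ 0) ; y = :- x in
       :- one :+ y :* (:- (con (+ 1) :+ one) :+ y :* (one :+ y :* (:- (con (+ 1) :+ (con (+ 1) :+ one))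
         :+ y :* (one :+ y :* con (+ 0)))))
       := :- con (+ 1) :+ x :* (con (+ 2) :+ x :* (con (+ 1) :+ x :* (con (+ 1) :+ con (+ 2) :+ x :* con (+ 1)))))
       refl x) , refl)

  -- quartic(-X) = X⁴ + 3X³ + X² + 2X - 1 changes sign between 0 and 2/3.
  quartic-small-root : ¬ ¬ (∃ λ w → Root quartic w × ∣ w ∣ ≤ 2/ 3)
  quartic-small-root κ = intermediate-value (evalʳ as) (evalʳ-continuous as) 0≤t
    (0<⇒< 0<1 (solve 1 (λ a → con (+ 1) := con (+ 0) :- (:- con (+ 1) :+ con (+ 0) :* a)) refl _))
    -- At t = 2/3 the terms 2t - 1 already sum to something nonnegative, and the terms of higher
    -- degree have positive coefficients.
    (≤-trans (0≤+ (≤⇒0≤- 1≤2t) (0≤* 0≤t (0≤* 0≤t (0≤+ (<⇒≤ 0<1) (0≤* 0≤t (0≤+ (<⇒≤ (0<+ 0<1 0<2)) 0≤t))))))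
      (≤-reflexive (solve 1 (λ t → (con (+ 2) :* t :- con (+ 1))
          :+ t :* (t :* (con (+ 1) :+ t :* (con (+ 1) :+ con (+ 2) :+ t)))
        := :- con (+ 1) :+ t :* (con (+ 2) :+ t :* (con (+ 1) :+ t :* (con (+ 1) :+ con (+ 2) :+ t :* con (+ 1))))) refl t)))
    λ (x , 0≤x , x≤t , gx≈0) → κ (ofReal (- x) , ℂR.trans (quartic-value x) (gx≈0 , refl)
      , ≤²⇒√≤ 0≤t (≤-trans (≤-reflexive (trans (N-ofReal (- x)) (solve 1 (λ x → (:- x) :* (:- x) := x :* x) refl x)))
          (*-mono-≤ 0≤x 0≤t x≤t x≤t)))
    where
    as = - 1# ∷ 2# ∷ 1# ∷ 1# + 2# ∷ []
    t = 2/ 3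
    0≤t = <⇒≤ (0<2/ 2)
    1≤2t : 1# ≤ 2# * t
    1≤2t = *-cancelʳ-≤ (fromℕ-pos 2) (≤-cong (sym (*-identityˡ _))
      (trans (fromℕ-* 2 2) (trans (*-cong (solve 0 (con (+ 1) :+ (con (+ 1) :+ con (+ 0)) := con (+ 2)) refl)
        (sym (2/-cancel 2))) (sym (*-assoc _ _ _)))) (fromℕ-mono {3} {4} (ℕ.m≤m+n 3 1)))

  -- The radicand is (m + 1)² - 4, so with k = m + 1 and B = 2/k the claim amounts to k - 2B ≤ √(k²
  -- - 4), which reduces to B² ≤ 1.
  c₃₊-bound : ∀ m → 1 ℕ.≤ m →
    (fromℕ m + 1# - √ (fromℕ m * fromℕ m + fromℕ 2 * fromℕ m - fromℕ 3)) * fromℕ 2 ⁻¹ ≤ 2/ (suc m)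
  c₃₊-bound m 1≤m = half-≤ (0≤⇒≤ (≤⇒0≤- root≥)
    (solve 3 (λ m b r → r :- ((con (+ 1) :+ m) :- (con (+ 1) :+ (con (+ 1) :+ con (+ 0))) :* b)
      := (con (+ 1) :+ (con (+ 1) :+ con (+ 0))) :* b :- ((m :+ con (+ 1)) :- r)) refl (fromℕ m) B (√ D)))
    where
    B = 2/ (suc m)
    D = fromℕ m * fromℕ m + fromℕ 2 * fromℕ m - fromℕ 3
    0≤B = <⇒≤ (0<2/ m)
    BB≤1 : B * B ≤ 1#
    BB≤1 = ≤-trans (*-mono-≤ 0≤B (<⇒≤ 0<1) (2/-≤1 m 1≤m) (2/-≤1 m 1≤m)) (≤-reflexive (*-identityʳ 1#))
    -- With k = m + 1 and k B = 2, (k - 2B)² = k² - 8 + 4B² ≤ k² - 4.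
    root≥ : fromℕ (suc m) - fromℕ 2 * B ≤ √ D
    root≥ = ²≤⇒≤√ (0≤⇒≤ (0≤* (fromℕ-nonneg 4) (≤⇒0≤- BB≤1)) (trans
      (solve 1 (λ b → let two = con (+ 1) :+ (con (+ 1) :+ con (+ 0)) in
         (con (+ 1) :+ (con (+ 1) :+ two)) :* (con (+ 1) :- b :* b)
           := con (+ 4) :* two :- con (+ 4) :- con (+ 4) :* (b :* b)) refl B)
      (trans (+-congʳ (+-congʳ (*-congˡ (sym (2/-cancel m)))))
      (solve 2 (λ m b → let two = con (+ 1) :+ (con (+ 1) :+ con (+ 0)) ; x = (con (+ 1) :+ m) :- two :* b in
         con (+ 4) :* (b :* (con (+ 1) :+ m)) :- con (+ 4) :- con (+ 4) :* (b :* b)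
           := (m :* m :+ two :* m :- (con (+ 1) :+ two)) :- x :* x) refl (fromℕ m) B))))

  c-bound : ∀ m → 1 ℕ.≤ m → ∀ c → IsC m c → c ≤ 2/ (suc m)
  c-bound _ _ c (c₁ c≈) = ≤-trans (≤-reflexive c≈) c₁-bound
  -- By minimality of |z|, any root of modulus at most 2/3 suffices; it is available under ¬¬
  -- because the goal is an inequality.
  c-bound _ _ c (c₂ z _ z-min c≈) = ≮⇒≥ λ 2/3<c → quartic-small-root λ (w , w-root , ∣w∣≤) →
    ≤⇒≯ (≤-trans (≤-reflexive c≈) (≤-trans (z-min w w-root) ∣w∣≤)) 2/3<c
  c-bound m 1≤m c (c₃₊ _ c≈) = ≤-trans (≤-reflexive c≈) (c₃₊-bound m 1≤m)

theorem2p3 : (R : CompleteOrderedField) → let open Pisot R in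
    (m : ℕ) → 1 ℕ.≤ m →
    (q : ℝ) → fromℕ m < q → q < fromℕ (m ℕ.+ 1) →
    IsPisot q → ¬ AlgebraicUnit (ofReal q) →
    (c : ℝ) → IsC m c →
    (q′ : ℂ) → GaloisConjugate (ofReal q) q′ →
    fromℕ 2 * fromℕ (m ℕ.+ 1) ⁻¹ ≤ ∣ q′ ∣ × c ≤ fromℕ 2 * fromℕ (m ℕ.+ 1) ⁻¹
theorem2p3 R m 1≤m q _ q<m+1 pisot non-unit c isC q′ conj rewrite ℕ.+-comm m 1 =
  conjugate-bound m 1≤m q q<m+1 pisot non-unit q′ conj , c-bound m 1≤m c isC
  where open ConjugateBounds R
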